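{- Let $r \geq 1$ and $d \geq 1$ be integers. Let $H$ be a bipartite graph with parts $V_1, V_2$ and $m$ edges such that there are $r$ vertices in $V_1$ each adjacent to every vertex of $V_2$, and every vertex of $V_1$ has degree at least $d$. Then for every graph $G$, $$t_H(G) \geq t_{K_{r,d}}(G)^{\frac{m}{rd}}.$$
   Context: All graphs are finite. A homomorphism from a graph $H$ to a graph $G$ is a map $f: V(H) \to V(G)$ such that for every edge $(u,v)$ of $H$, $(f(u),f(v))$ is an edge of $G$. Let $h_H(G)$ be the number of homomorphisms from $H$ to $G$, and $t_H(G) = h_H(G)/|V(G)|^{|V(H)|}$ the fraction of all maps $V(H)\to V(G)$ that are homomorphisms. $K_{r,d}$ denotes the complete bipartite graph with parts of sizes $r$ and $d$. -}

module Defs where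

open import Data.Nat as ℕ using (ℕ; zero; suc; _<ᵇ_; _<_; NonZero)
open import Data.Nat.Properties using (m^n≢0)
open import Data.Bool using (Bool; true; false; not; _∧_; _∨_; _xor_; if_then_else_)
open import Data.Bool.Properties using (xor-comm; xor-same)
open import Data.Fin using (Fin; toℕ)
open import Data.List using (List; []; _∷_; map; concatMap; allFin)
open import Data.Nat.ListAction using (sum)
open import Data.Vec.Functional using () renaming (_∷_ to _◂_)
open import Data.Integer using (+_)
open import Data.Rational using (ℚ; _/_; 1ℚ; _*_)
open import Relation.Binary.PropositionalEquality using (_≡_)

record Graph (n : ℕ) : Set where
  field
    adj    : Fin n → Fin n → Bool
    sym    : ∀ u v → adj u v ≡ adj v u
    irrefl : ∀ v → adj v v ≡ false
open Graph public

countB : {A : Set} → (A → Bool) → List A → ℕ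
countB p xs = sum (map (λ x → if p x then 1 else 0) xs)

allB : {A : Set} → (A → Bool) → List A → Bool
allB p []       = true
allB p (x ∷ xs) = p x ∧ allB p xs

allMaps : (k n : ℕ) → List (Fin k → Fin n)
allMaps zero    n = (λ ()) ∷ []
allMaps (suc k) n = concatMap (λ f → map (λ x → x ◂ f) (allFin n)) (allMaps k n)

isHom : {k n : ℕ} → Graph k → Graph n → (Fin k → Fin n) → Bool
isHom {k} H G f =
  allB (λ u → allB (λ v → not (adj H u v) ∨ adj G (f u) (f v)) (allFin k)) (allFin k)

homCount : {k n : ℕ} → Graph k → Graph n → ℕ
homCount {k} {n} H G = countB (isHom H G) (allMaps k n)

homDensity : {k n : ℕ} → Graph k → Graph (suc n) → ℚ
homDensity {k} {n} H G = (+ homCount H G) / (suc n ℕ.^ k)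
  where instance _ = m^n≢0 (suc n) k

edgeCount : {k : ℕ} → Graph k → ℕ
edgeCount {k} H =
  sum (map (λ u → countB (λ v → (toℕ u <ᵇ toℕ v) ∧ adj H u v) (allFin k)) (allFin k))

degree : {k : ℕ} → Graph k → Fin k → ℕ
degree {k} H u = countB (adj H u) (allFin k)

K : (r d : ℕ) → Graph (r ℕ.+ d)
K r d = record
  { adj    = λ i j → (toℕ i <ᵇ r) xor (toℕ j <ᵇ r)
  ; sym    = λ i j → xor-comm (toℕ i <ᵇ r) (toℕ j <ᵇ r)
  ; irrefl = λ i → xor-same (toℕ i <ᵇ r)
  }

_^ℚ_ : ℚ → ℕ → ℚ
q ^ℚ zero  = 1ℚ
q ^ℚ suc e = q * (q ^ℚ e)

{-# OPTIONS --safe #-}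
module Submission where

-- Let t = t_K(G) for K = K_{r,d}.  Draw an r-tuple x of vertices with density c(x)^d / t, where
-- c(x) is the proportion of common neighbours of x, and then a map g of V₂ whose values are
-- independent and uniform among the common neighbours of x.  By Jensen's inequality
--   log t_H ≥ log t + (|V₂| - d) E log c(x) + Σ_u E log c(g(N(u))),
-- where u runs over the vertices of V₁ outside the r complete ones.  Comparing relative entropies
-- with the uniform distribution, and with the distribution that draws g(N(u)) uniformly and then
-- x among the tuples joined to it, gives
--   d E log c(x) ≥ log t   and   r E log c(g(N(u))) ≥ log t + (|N(u)| - d) E log c(x),
-- and these add up to log t_H ≥ (m / rd) log t.  Probabilities are replaced by integer weights and
-- expectations of logarithms by weighted products, so that every step is an inequality in ℕ.

open import Defs renaming (sym to adj-sym)
open import Data.Nat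
open import Data.Nat.Properties
open import Data.Nat.Divisibility using (∣-trans; m∣m*n; m≤n⇒m!∣n!)
open import Data.Nat.DivMod using (m*[n/m]≡n)
open import Data.Nat.ListAction using (sum; product)
open import Data.Nat.ListAction.Properties using (sum-↭; product-↭)
open import Data.Nat.Tactic.RingSolver using (solve-∀)
open import Data.Bool using (Bool; true; false; not; if_then_else_; _∧_; _∨_)
open import Data.Bool.Properties using (T-≡)
open import Data.Empty using (⊥)
open import Data.Fin using (Fin; zero; suc; toℕ; splitAt; _↑ˡ_; _↑ʳ_; fromℕ<)
open import Data.Fin.Properties using (toℕ-↑ˡ; toℕ-↑ʳ; toℕ<n; toℕ-injective)
import Data.Integer as ℤ
import Data.Integer.Properties as ℤ
open import Data.List using (List; []; _∷_; _++_; map; concatMap; length; allFin; replicate; cartesianProduct)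
open import Data.List.Membership.Propositional using (_∈_)
open import Data.List.Membership.Propositional.Properties using (∈-allFin; ∈-∃++)
open import Data.List.Properties using (length-++; length-map; length-replicate; length-tabulate; map-tabulate)
open import Data.List.Relation.Binary.Permutation.Propositional using (_↭_; ↭-refl; ↭-trans; prep)
open import Data.List.Relation.Binary.Permutation.Propositional.Properties
  using (shift; ∈-resp-↭; ↭-length) renaming (map⁺ to ↭-map⁺)
import Data.List.Relation.Unary.All as All
open import Data.List.Relation.Unary.AllPairs using ([]; _∷_)
open import Data.List.Relation.Unary.Any using (here; there)
open import Data.List.Relation.Unary.Unique.Propositional using (Unique)
open import Data.List.Relation.Unary.Unique.Propositional.Properties using (map⁺; allFin⁺)
open import Data.Product using (Σ; ∃; _×_; _,_; proj₁; proj₂)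
import Data.Rational as ℚ
open import Data.Rational using () renaming (_≤_ to _≤ℚ_)
import Data.Rational.Properties as ℚ
import Data.Rational.Unnormalised as ℚᵘ
import Data.Rational.Unnormalised.Properties as ℚᵘ
open import Data.Sum using (_⊎_; inj₁; inj₂)
open import Data.Vec.Functional using () renaming (_∷_ to _◂_; _++_ to _⧺_)
open import Data.Vec.Functional.Properties using (lookup-++ˡ; lookup-++ʳ)
open import Function using (id; _∘_; Equivalence)
open import Function.Definitions using (Injective)
open import Relation.Binary.PropositionalEquality
open import Relation.Nullary using (yes; no; contradiction)

-- The density c(x)^d is the one for which x together with d independent common neighbours is a
-- uniform homomorphism from K_{r,d}. The number M = E log c(x) is unknown and has to be eliminated.
-- After multiplication by rd, it enters the sum of the bounds with coefficient rd(|V₂| - d) + d Σ_u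
-- (|N(u)| - d). The degree condition makes this nonnegative, so dM ≥ log t may be inserted, and log
-- t then occurs rd + r(|V₂| - d) + Σ_u |N(u)| = m times.
--
-- Two devices keep everything in ℕ. A uniform choice among c candidates has density 1/c, which is
-- replaced by the integer n!/c.

private variable
  A B : Set
  k n : ℕ

-- Sums and products over lists

∑ ∏ : List A → (A → ℕ) → ℕ
∑ xs f = sum (map f xs)
∏ xs f = product (map f xs)

∑-cong : (xs : List A) {f g : A → ℕ} → (∀ x → f x ≡ g x) → ∑ xs f ≡ ∑ xs g
∑-cong []       f≗g = refl
∑-cong (x ∷ xs) f≗g = cong₂ _+_ (f≗g x) (∑-cong xs f≗g)

∑-mono-≤ : (xs : List A) {f g : A → ℕ} → (∀ x → f x ≤ g x) → ∑ xs f ≤ ∑ xs g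
∑-mono-≤ []       f≤g = z≤n
∑-mono-≤ (x ∷ xs) f≤g = +-mono-≤ (f≤g x) (∑-mono-≤ xs f≤g)

∑-const : (xs : List A) (c : ℕ) → ∑ xs (λ _ → c) ≡ length xs * c
∑-const []       c = refl
∑-const (x ∷ xs) c = cong (c +_) (∑-const xs c)

∑-distrib-+ : (xs : List A) (f g : A → ℕ) → ∑ xs (λ x → f x + g x) ≡ ∑ xs f + ∑ xs g
∑-distrib-+ []       f g = refl
∑-distrib-+ (x ∷ xs) f g rewrite ∑-distrib-+ xs f g = lemma (f x) (g x) (∑ xs f) (∑ xs g)
  where
  lemma : ∀ a b c d → a + b + (c + d) ≡ a + c + (b + d)
  lemma = solve-∀

*-distribˡ-∑ : (c : ℕ) (xs : List A) (f : A → ℕ) → c * ∑ xs f ≡ ∑ xs (λ x → c * f x)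
*-distribˡ-∑ c []       f = *-zeroʳ c
*-distribˡ-∑ c (x ∷ xs) f =
  trans (*-distribˡ-+ c (f x) (∑ xs f)) (cong (c * f x +_) (*-distribˡ-∑ c xs f))

*-distribʳ-∑ : (c : ℕ) (xs : List A) (f : A → ℕ) → ∑ xs f * c ≡ ∑ xs (λ x → f x * c)
*-distribʳ-∑ c []       f = refl
*-distribʳ-∑ c (x ∷ xs) f =
  trans (*-distribʳ-+ c (f x) (∑ xs f)) (cong (f x * c +_) (*-distribʳ-∑ c xs f))

∑-swap : (xs : List A) (ys : List B) (f : A → B → ℕ) →
         ∑ xs (λ x → ∑ ys (f x)) ≡ ∑ ys (λ y → ∑ xs (λ x → f x y))
∑-swap []       ys f = sym (trans (∑-const ys 0) (*-zeroʳ (length ys)))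
∑-swap (x ∷ xs) ys f = trans (cong (∑ ys (f x) +_) (∑-swap xs ys f))
  (sym (∑-distrib-+ ys (f x) (λ y → ∑ xs (λ x′ → f x′ y))))

∑-++ : (xs ys : List A) (f : A → ℕ) → ∑ (xs ++ ys) f ≡ ∑ xs f + ∑ ys f
∑-++ []       ys f = refl
∑-++ (x ∷ xs) ys f = trans (cong (f x +_) (∑-++ xs ys f)) (sym (+-assoc (f x) _ _))

∑-map : (h : A → B) (xs : List A) (f : B → ℕ) → ∑ (map h xs) f ≡ ∑ xs (f ∘ h)
∑-map h []       f = refl
∑-map h (x ∷ xs) f = cong (f (h x) +_) (∑-map h xs f)

∑-concatMap : (h : A → List B) (xs : List A) (f : B → ℕ) →
              ∑ (concatMap h xs) f ≡ ∑ xs (λ x → ∑ (h x) f)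
∑-concatMap h []       f = refl
∑-concatMap h (x ∷ xs) f =
  trans (∑-++ (h x) (concatMap h xs) f) (cong (∑ (h x) f +_) (∑-concatMap h xs f))

^-distribʳ-* : ∀ m n o → (m * n) ^ o ≡ m ^ o * n ^ o
^-distribʳ-* m n zero    = refl
^-distribʳ-* m n (suc o) rewrite ^-distribʳ-* m n o = lemma m n (m ^ o) (n ^ o)
  where
  lemma : ∀ a b c d → a * b * (c * d) ≡ a * c * (b * d)
  lemma = solve-∀

∏-cong : (xs : List A) {f g : A → ℕ} → (∀ x → f x ≡ g x) → ∏ xs f ≡ ∏ xs g
∏-cong []       f≗g = refl
∏-cong (x ∷ xs) f≗g = cong₂ _*_ (f≗g x) (∏-cong xs f≗g)

∏-mono-≤ : (xs : List A) {f g : A → ℕ} → (∀ x → f x ≤ g x) → ∏ xs f ≤ ∏ xs g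
∏-mono-≤ []       f≤g = ≤-refl
∏-mono-≤ (x ∷ xs) f≤g = *-mono-≤ (f≤g x) (∏-mono-≤ xs f≤g)

∏-const : (xs : List A) (c : ℕ) → ∏ xs (λ _ → c) ≡ c ^ length xs
∏-const []       c = refl
∏-const (x ∷ xs) c = cong (c *_) (∏-const xs c)

∏-distrib-* : (xs : List A) (f g : A → ℕ) → ∏ xs (λ x → f x * g x) ≡ ∏ xs f * ∏ xs g
∏-distrib-* []       f g = refl
∏-distrib-* (x ∷ xs) f g rewrite ∏-distrib-* xs f g = lemma (f x) (g x) (∏ xs f) (∏ xs g)
  where
  lemma : ∀ a b c d → a * b * (c * d) ≡ a * c * (b * d)
  lemma = solve-∀

∏-^ : (xs : List A) (f : A → ℕ) (m : ℕ) → ∏ xs (λ x → f x ^ m) ≡ ∏ xs f ^ m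
∏-^ []       f m = sym (^-zeroˡ m)
∏-^ (x ∷ xs) f m = trans (cong (f x ^ m *_) (∏-^ xs f m)) (sym (^-distribʳ-* (f x) _ m))

∏-swap : (xs : List A) (ys : List B) (f : A → B → ℕ) →
         ∏ xs (λ x → ∏ ys (f x)) ≡ ∏ ys (λ y → ∏ xs (λ x → f x y))
∏-swap []       ys f = sym (trans (∏-const ys 1) (^-zeroˡ (length ys)))
∏-swap (x ∷ xs) ys f = trans (cong (∏ ys (f x) *_) (∏-swap xs ys f))
  (sym (∏-distrib-* ys (f x) (λ y → ∏ xs (λ x′ → f x′ y))))

∏-++ : (xs ys : List A) (f : A → ℕ) → ∏ (xs ++ ys) f ≡ ∏ xs f * ∏ ys f
∏-++ []       ys f = sym (*-identityˡ _)
∏-++ (x ∷ xs) ys f = trans (cong (f x *_) (∏-++ xs ys f)) (sym (*-assoc (f x) _ _))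

∏-map : (h : A → B) (xs : List A) (f : B → ℕ) → ∏ (map h xs) f ≡ ∏ xs (f ∘ h)
∏-map h []       f = refl
∏-map h (x ∷ xs) f = cong (f (h x) *_) (∏-map h xs f)

∏-pos : (xs : List A) {f : A → ℕ} → (∀ x → 0 < f x) → 0 < ∏ xs f
∏-pos []       f>0 = s≤s z≤n
∏-pos (x ∷ xs) f>0 = *-mono-< (f>0 x) (∏-pos xs f>0)

^-pos : ∀ {m} n → 0 < m → 0 < m ^ n
^-pos {m} n m>0 = m^n>0 m {{>-nonZero m>0}} n

*-cancelˡ-≤-pos : ∀ {m n} o → 0 < o → o * m ≤ o * n → m ≤ n
*-cancelˡ-≤-pos o o>0 = *-cancelˡ-≤ o {{>-nonZero o>0}}

^-cancelʳ-≤ : ∀ {m n} o → 0 < o → m ^ o ≤ n ^ o → m ≤ n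
^-cancelʳ-≤ {m} {n} o o>0 mᵒ≤nᵒ with m ≤? n
... | yes m≤n = m≤n
... | no  m≰n = contradiction mᵒ≤nᵒ (<⇒≱ (^-monoˡ-< o {{>-nonZero o>0}} (≰⇒> m≰n)))

-- Since `0 ^ 0` is 1, a factor of this form can be cancelled even when a list is empty or a total
-- weight is zero.
m^m>0 : ∀ m → 0 < m ^ m
m^m>0 zero    = s≤s z≤n
m^m>0 (suc m) = ^-pos (suc m) (s≤s z≤n)

-- Gibbs' inequality

2xy≤x²+y² : ∀ x y → 2 * (x * y) ≤ x * x + y * y
2xy≤x²+y² x y with ≤-total x y
... | inj₁ x≤y = subst (λ y → 2 * (x * y) ≤ x * x + y * y) (m+[n∸m]≡n x≤y)
                   (le x (y ∸ x))
  where
  eq : ∀ x z → x * x + (x + z) * (x + z) ≡ 2 * (x * (x + z)) + z * z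
  eq = solve-∀
  le : ∀ x z → 2 * (x * (x + z)) ≤ x * x + (x + z) * (x + z)
  le x z rewrite eq x z = m≤m+n _ _
... | inj₂ y≤x = subst (λ x → 2 * (x * y) ≤ x * x + y * y) (m+[n∸m]≡n y≤x)
                   (le y (x ∸ y))
  where
  eq : ∀ y z → (y + z) * (y + z) + y * y ≡ 2 * ((y + z) * y) + z * z
  eq = solve-∀
  le : ∀ y z → 2 * ((y + z) * y) ≤ (y + z) * (y + z) + y * y
  le y z rewrite eq y z = m≤m+n _ _

-- The tangent line to y ↦ y ^ (1 + n) at z, without subtraction.
bernoulli : ∀ n y z → suc n * (z ^ n * y) ≤ y ^ suc n + n * z ^ suc n
bernoulli zero    y z = ≤-reflexive (lemma y)
  where
  lemma : ∀ y → 1 * (1 * y) ≡ y * 1 + 0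
  lemma = solve-∀
-- Adding `n * (z * Z * y)` to both sides produces the factor `2 * (y * z)`. The bound for squares
-- applies to it, and the induction hypothesis is then used multiplied by `y`.
bernoulli (suc n) y z = +-cancelʳ-≤ (n * (z * Z * y)) _ _ (begin
  suc (suc n) * (z * Z * y) + n * (z * Z * y)  ≡⟨ eq₁ n y z Z ⟩
  suc n * Z * (2 * (y * z))                    ≤⟨ *-monoʳ-≤ (suc n * Z) (2xy≤x²+y² y z) ⟩
  suc n * Z * (y * y + z * z)                  ≡⟨ eq₂ n y z Z ⟩
  y * (suc n * (Z * y)) + suc n * (z * (z * Z))
    ≤⟨ +-monoˡ-≤ _ (*-monoʳ-≤ y (bernoulli n y z)) ⟩
  y * (y * Y + n * (z * Z)) + suc n * (z * (z * Z))  ≡⟨ eq₃ n y z Y Z ⟩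
  y * (y * Y) + suc n * (z * (z * Z)) + n * (z * Z * y)  ∎)
  where
  open ≤-Reasoning
  Y = y ^ n
  Z = z ^ n
  eq₁ : ∀ n y z Z → suc (suc n) * (z * Z * y) + n * (z * Z * y) ≡ suc n * Z * (2 * (y * z))
  eq₁ = solve-∀
  eq₂ : ∀ n y z Z → suc n * Z * (y * y + z * z) ≡ y * (suc n * (Z * y)) + suc n * (z * (z * Z))
  eq₂ = solve-∀
  eq₃ : ∀ n y z Y Z → y * (y * Y + n * (z * Z)) + suc n * (z * (z * Z))
                    ≡ y * (y * Y) + suc n * (z * (z * Z)) + n * (z * Z * y)
  eq₃ = solve-∀

-- For positive `n` this is Bernoulli's inequality at the mean of all `suc n` terms and the mean of
-- the first `n` with sum `S`, both scaled by `n * suc n` to become the integers `y` and `z`.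
amgm-step : ∀ n S x → suc n ^ suc n * (S ^ n * x) ≤ n ^ n * (S + x) ^ suc n
amgm-step zero    S x = ≤-trans (m≤n+m _ S) (≤-reflexive (lemma S x))
  where
  lemma : ∀ S x → S + 1 * (1 * x) ≡ 1 * ((S + x) * 1)
  lemma = solve-∀
amgm-step n@(suc _) S x = *-cancelˡ-≤ n (+-cancelʳ-≤ (n * z ^ suc n) _ _ (begin
  n * (suc n ^ suc n * (S ^ n * x)) + n * z ^ suc n
    ≡⟨ cong (λ q → n * (suc n ^ suc n * (S ^ n * x)) + n * (z * q)) (^-distribʳ-* (suc n) S n) ⟩
  n * (suc n ^ suc n * (S ^ n * x)) + n * (z * (suc n ^ n * S ^ n))
    ≡⟨ eq₁ n S x (suc n ^ n) (S ^ n) ⟩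
  suc n * (suc n ^ n * S ^ n * y)
    ≡⟨ cong (λ q → suc n * (q * y)) (^-distribʳ-* (suc n) S n) ⟨
  suc n * (z ^ n * y)
    ≤⟨ bernoulli n y z ⟩
  y * y ^ n + n * z ^ suc n
    ≡⟨ cong (λ q → y * q + n * z ^ suc n) (^-distribʳ-* n (S + x) n) ⟩
  y * (n ^ n * (S + x) ^ n) + n * z ^ suc n
    ≡⟨ cong (_+ n * z ^ suc n) (eq₂ n (S + x) (n ^ n) ((S + x) ^ n)) ⟩
  n * (n ^ n * (S + x) ^ suc n) + n * z ^ suc n ∎))
  where
  open ≤-Reasoning
  y = n * (S + x)
  z = suc n * S
  eq₁ : ∀ n S x M P → n * (suc n * M * (P * x)) + n * (suc n * S * (M * P))
                    ≡ suc n * (M * P * (n * (S + x)))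
  eq₁ = solve-∀
  eq₂ : ∀ n s N P → n * s * (N * P) ≡ n * (N * (s * P))
  eq₂ = solve-∀

amgm : (xs : List A) (f : A → ℕ) → length xs ^ length xs * ∏ xs f ≤ ∑ xs f ^ length xs
amgm []       f = ≤-refl
amgm (x ∷ xs) f = *-cancelˡ-≤-pos (L ^ L) (m^m>0 L) (begin
  L ^ L * (suc L ^ suc L * (f x * ∏ xs f))  ≡⟨ eq₁ (L ^ L) (suc L ^ suc L) (f x) (∏ xs f) ⟩
  suc L ^ suc L * (L ^ L * ∏ xs f * f x)
    ≤⟨ *-monoʳ-≤ (suc L ^ suc L) (*-monoˡ-≤ (f x) (amgm xs f)) ⟩
  suc L ^ suc L * (∑ xs f ^ L * f x)        ≤⟨ amgm-step L (∑ xs f) (f x) ⟩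
  L ^ L * (∑ xs f + f x) ^ suc L            ≡⟨ cong (λ q → L ^ L * q ^ suc L) (+-comm _ (f x)) ⟩
  L ^ L * (f x + ∑ xs f) ^ suc L            ∎)
  where
  open ≤-Reasoning
  L = length xs
  eq₁ : ∀ a b c d → a * (b * (c * d)) ≡ b * (a * d * c)
  eq₁ = solve-∀

∑-replicate : ∀ a (x : A) (f : A → ℕ) → ∑ (replicate a x) f ≡ a * f x
∑-replicate zero    x f = refl
∑-replicate (suc a) x f = cong (f x +_) (∑-replicate a x f)

∏-replicate : ∀ a (x : A) (f : A → ℕ) → ∏ (replicate a x) f ≡ f x ^ a
∏-replicate zero    x f = refl
∏-replicate (suc a) x f = cong (f x *_) (∏-replicate a x f)

-- Weighted AM-GM for u/a and v/b with weights `a` and `b`. Clearing denominators gives `a` copies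
-- of `u * b` and `b` copies of `v * a`, whose sum factors as `(u + v) * (a * b)`. Zero weights are
-- separate because the cancelled factor `b ^ a * a ^ b` may vanish there.
amgm₂ : ∀ a b u v → (a + b) ^ (a + b) * (u ^ a * v ^ b) ≤ (u + v) ^ (a + b) * (a ^ a * b ^ b)
amgm₂ zero b u v = begin
  b ^ b * (1 * v ^ b)        ≡⟨ eq (b ^ b) (v ^ b) ⟩
  v ^ b * (1 * b ^ b)        ≤⟨ *-monoˡ-≤ (1 * b ^ b) (^-monoˡ-≤ b (m≤n+m v u)) ⟩
  (u + v) ^ b * (1 * b ^ b)  ∎
  where
  open ≤-Reasoning
  eq : ∀ p q → p * (1 * q) ≡ q * (1 * p)
  eq = solve-∀
amgm₂ a@(suc a′) zero u v rewrite +-identityʳ a′ = begin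
  a ^ a * (u ^ a * 1)        ≡⟨ eq (a ^ a) (u ^ a) ⟩
  u ^ a * (a ^ a * 1)        ≤⟨ *-monoˡ-≤ (a ^ a * 1) (^-monoˡ-≤ a (m≤m+n u v)) ⟩
  (u + v) ^ a * (a ^ a * 1)  ∎
  where
  open ≤-Reasoning
  eq : ∀ p q → p * (q * 1) ≡ q * (p * 1)
  eq = solve-∀
amgm₂ a@(suc _) b@(suc _) u v = *-cancelˡ-≤-pos (b ^ a * a ^ b) (*-mono-< (^-pos a (s≤s z≤n)) (^-pos b (s≤s z≤n))) (begin
  b ^ a * a ^ b * ((a + b) ^ (a + b) * (u ^ a * v ^ b))
    ≡⟨ eq₁ (b ^ a) (a ^ b) ((a + b) ^ (a + b)) (u ^ a) (v ^ b) ⟩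
  (a + b) ^ (a + b) * ((u ^ a * b ^ a) * (v ^ b * a ^ b))
    ≡⟨ cong ((a + b) ^ (a + b) *_) (cong₂ _*_ (^-distribʳ-* u b a) (^-distribʳ-* v a b)) ⟨
  (a + b) ^ (a + b) * ((u * b) ^ a * (v * a) ^ b)
    ≡⟨ cong₂ _*_ (cong (λ l → l ^ l) len) prod ⟨
  length xs ^ length xs * ∏ xs id
    ≤⟨ amgm xs id ⟩
  ∑ xs id ^ length xs
    ≡⟨ cong₂ _^_ tot len ⟩
  (a * (u * b) + b * (v * a)) ^ (a + b)
    ≡⟨ cong (_^ (a + b)) (eq₂ a b u v) ⟩
  ((u + v) * (a * b)) ^ (a + b)
    ≡⟨ ^-distribʳ-* (u + v) (a * b) (a + b) ⟩
  (u + v) ^ (a + b) * (a * b) ^ (a + b)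
    ≡⟨ cong ((u + v) ^ (a + b) *_) (^-distribˡ-+-* (a * b) a b) ⟩
  (u + v) ^ (a + b) * ((a * b) ^ a * (a * b) ^ b)
    ≡⟨ cong ((u + v) ^ (a + b) *_) (cong₂ _*_ (^-distribʳ-* a b a) (^-distribʳ-* a b b)) ⟩
  (u + v) ^ (a + b) * ((a ^ a * b ^ a) * (a ^ b * b ^ b))
    ≡⟨ eq₃ ((u + v) ^ (a + b)) (a ^ a) (b ^ a) (a ^ b) (b ^ b) ⟩
  b ^ a * a ^ b * ((u + v) ^ (a + b) * (a ^ a * b ^ b)) ∎)
  where
  open ≤-Reasoning
  xs = replicate a (u * b) ++ replicate b (v * a)
  len : length xs ≡ a + b
  len = trans (length-++ (replicate a (u * b))) (cong₂ _+_ (length-replicate a) (length-replicate b))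
  prod : ∏ xs id ≡ (u * b) ^ a * (v * a) ^ b
  prod = trans (∏-++ (replicate a (u * b)) _ id) (cong₂ _*_ (∏-replicate a (u * b) id) (∏-replicate b (v * a) id))
  tot : ∑ xs id ≡ a * (u * b) + b * (v * a)
  tot = trans (∑-++ (replicate a (u * b)) _ id) (cong₂ _+_ (∑-replicate a (u * b) id) (∑-replicate b (v * a) id))
  eq₁ : ∀ p q r s t → p * q * (r * (s * t)) ≡ r * ((s * p) * (t * q))
  eq₁ = solve-∀
  eq₂ : ∀ a b u v → a * (u * b) + b * (v * a) ≡ (u + v) * (a * b)
  eq₂ = solve-∀
  eq₃ : ∀ p q r s t → p * ((q * r) * (s * t)) ≡ r * s * (p * (q * t))
  eq₃ = solve-∀

-- Gibbs' inequality Σ w log (u / w) ≤ W log (U / W), exponentiated and with denominators cleared.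
gibbs : (xs : List A) (w u : A → ℕ) →
        ∑ xs w ^ ∑ xs w * ∏ xs (λ x → u x ^ w x) ≤ ∑ xs u ^ ∑ xs w * ∏ xs (λ x → w x ^ w x)
gibbs []       w u = ≤-refl
-- The chain rule for relative entropy: the tail is merged into one point with weight `b` and
-- comparison value `v`, so that the two-term inequality completes the induction.
gibbs (x ∷ xs) w u = *-cancelˡ-≤-pos (b ^ b) (m^m>0 b) (begin
  b ^ b * ((a + b) ^ (a + b) * (u x ^ a * Pu))
    ≡⟨ eq₁ (b ^ b) ((a + b) ^ (a + b)) (u x ^ a) Pu ⟩
  (a + b) ^ (a + b) * u x ^ a * (b ^ b * Pu)
    ≤⟨ *-monoʳ-≤ ((a + b) ^ (a + b) * u x ^ a) (gibbs xs w u) ⟩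
  (a + b) ^ (a + b) * u x ^ a * (v ^ b * Pw)
    ≡⟨ eq₂ ((a + b) ^ (a + b)) (u x ^ a) (v ^ b) Pw ⟩
  (a + b) ^ (a + b) * (u x ^ a * v ^ b) * Pw
    ≤⟨ *-monoˡ-≤ Pw (amgm₂ a b (u x) v) ⟩
  (u x + v) ^ (a + b) * (a ^ a * b ^ b) * Pw
    ≡⟨ eq₃ ((u x + v) ^ (a + b)) (a ^ a) (b ^ b) Pw ⟩
  b ^ b * ((u x + v) ^ (a + b) * (a ^ a * Pw)) ∎)
  where
  open ≤-Reasoning
  a = w x
  b = ∑ xs w
  v = ∑ xs u
  Pu = ∏ xs (λ x → u x ^ w x)
  Pw = ∏ xs (λ x → w x ^ w x)
  eq₁ : ∀ p q r s → p * (q * (r * s)) ≡ q * r * (p * s)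
  eq₁ = solve-∀
  eq₂ : ∀ p q r s → p * q * (r * s) ≡ p * (q * r) * s
  eq₂ = solve-∀
  eq₃ : ∀ p q r s → p * (q * r) * s ≡ r * (p * (q * s))
  eq₃ = solve-∀

-- Sums over maps

allFin-suc : ∀ k → allFin (suc k) ≡ zero ∷ map suc (allFin k)
allFin-suc k = cong (zero ∷_) (sym (map-tabulate id suc))

∏-allFin-suc : ∀ k (f : Fin (suc k) → ℕ) → ∏ (allFin (suc k)) f ≡ f zero * ∏ (allFin k) (f ∘ suc)
∏-allFin-suc k f = trans (cong (λ xs → ∏ xs f) (allFin-suc k)) (cong (f zero *_) (∏-map suc (allFin k) f))

length-allFin : ∀ k → length (allFin k) ≡ k
length-allFin k = length-tabulate {n = k} id

∑-allFin-const : ∀ k c → ∑ (allFin k) (λ _ → c) ≡ k * c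
∑-allFin-const k c = trans (∑-const (allFin k) c) (cong (_* c) (length-allFin k))

∏-allFin-const : ∀ k c → ∏ (allFin k) (λ _ → c) ≡ c ^ k
∏-allFin-const k c = trans (∏-const (allFin k) c) (cong (c ^_) (length-allFin k))

∑-allMaps-suc : (F : (Fin (suc k) → Fin n) → ℕ) →
                ∑ (allMaps (suc k) n) F ≡ ∑ (allMaps k n) (λ f → ∑ (allFin n) (λ x → F (x ◂ f)))
∑-allMaps-suc {k} {n} F = trans
  (∑-concatMap (λ f → map (λ x → x ◂ f) (allFin n)) (allMaps k n) F)
  (∑-cong (allMaps k n) (λ f → ∑-map (λ x → x ◂ f) (allFin n) F))

∑-allMaps-const : ∀ k n c → ∑ (allMaps k n) (λ _ → c) ≡ n ^ k * c
∑-allMaps-const zero    n c = refl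
∑-allMaps-const (suc k) n c = begin
  ∑ (allMaps (suc k) n) (λ _ → c)                      ≡⟨ ∑-allMaps-suc {k} (λ _ → c) ⟩
  ∑ (allMaps k n) (λ _ → ∑ (allFin n) (λ _ → c))       ≡⟨ ∑-allMaps-const k n _ ⟩
  n ^ k * ∑ (allFin n) (λ _ → c)                       ≡⟨ cong (n ^ k *_) (∑-allFin-const n c) ⟩
  n ^ k * (n * c)                                      ≡⟨ eq n (n ^ k) c ⟩
  n ^ suc k * c                                        ∎
  where
  open ≡-Reasoning
  eq : ∀ n p c → p * (n * c) ≡ n * p * c
  eq = solve-∀

∑-∏-allMaps : ∀ k (φ : Fin k → Fin n → ℕ) →
              ∑ (allMaps k n) (λ f → ∏ (allFin k) (λ i → φ i (f i))) ≡ ∏ (allFin k) (λ i → ∑ (allFin n) (φ i))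
∑-∏-allMaps zero φ = refl
∑-∏-allMaps {n} (suc k) φ = begin
  ∑ (allMaps (suc k) n) (λ f → ∏ (allFin (suc k)) (λ i → φ i (f i)))
    ≡⟨ ∑-allMaps-suc {k} _ ⟩
  ∑ (allMaps k n) (λ f → ∑ (allFin n) (λ x → ∏ (allFin (suc k)) (λ i → φ i ((x ◂ f) i))))
    ≡⟨ ∑-cong (allMaps k n) (λ f → ∑-cong (allFin n) (λ x → ∏-allFin-suc k (λ i → φ i ((x ◂ f) i)))) ⟩
  ∑ (allMaps k n) (λ f → ∑ (allFin n) (λ x → φ zero x * P f))
    ≡⟨ ∑-cong (allMaps k n) (λ f → *-distribʳ-∑ (P f) (allFin n) (φ zero)) ⟨
  ∑ (allMaps k n) (λ f → ∑ (allFin n) (φ zero) * P f)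
    ≡⟨ *-distribˡ-∑ (∑ (allFin n) (φ zero)) (allMaps k n) P ⟨
  ∑ (allFin n) (φ zero) * ∑ (allMaps k n) P
    ≡⟨ cong (∑ (allFin n) (φ zero) *_) (∑-∏-allMaps k (φ ∘ suc)) ⟩
  ∑ (allFin n) (φ zero) * ∏ (allFin k) (λ i → ∑ (allFin n) (φ (suc i)))
    ≡⟨ ∏-allFin-suc k (λ i → ∑ (allFin n) (φ i)) ⟨
  ∏ (allFin (suc k)) (λ i → ∑ (allFin n) (φ i)) ∎
  where
  open ≡-Reasoning
  P : (Fin k → Fin n) → ℕ
  P f = ∏ (allFin k) (λ i → φ (suc i) (f i))

-- Rearranging a map, as in `x ◂ (f ⧺ g)`, gives only a pointwise equal map. Without function
-- extensionality the summand itself has to respect pointwise equality.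
Extensional : ((Fin k → A) → ℕ) → Set
Extensional F = ∀ {f g} → (∀ i → f i ≡ g i) → F f ≡ F g

◂-cong : (x : A) {f g : Fin k → A} → (∀ i → f i ≡ g i) → ∀ i → (x ◂ f) i ≡ (x ◂ g) i
◂-cong x f≗g zero    = refl
◂-cong x f≗g (suc i) = f≗g i

∑-allMaps-++ : ∀ r d (F : (Fin (r + d) → Fin n) → ℕ) → Extensional F →
               ∑ (allMaps (r + d) n) F ≡ ∑ (allMaps d n) (λ g → ∑ (allMaps r n) (λ f → F (f ⧺ g)))
∑-allMaps-++ {n} zero d F ext = ∑-cong (allMaps d n) (λ g → sym (+-identityʳ (F g)))
∑-allMaps-++ {n} (suc r) d F ext = begin
  ∑ (allMaps (suc r + d) n) F
    ≡⟨ ∑-allMaps-suc {r + d} F ⟩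
  ∑ (allMaps (r + d) n) F′
    ≡⟨ ∑-allMaps-++ r d F′ (λ f≗g → ∑-cong (allFin n) (λ x → ext (◂-cong x f≗g))) ⟩
  ∑ (allMaps d n) (λ g → ∑ (allMaps r n) (λ f → ∑ (allFin n) (λ x → F (x ◂ (f ⧺ g)))))
    ≡⟨ ∑-cong (allMaps d n) (λ g → ∑-cong (allMaps r n) (λ f → ∑-cong (allFin n) (λ x → ext (assoc x f g)))) ⟩
  ∑ (allMaps d n) (λ g → ∑ (allMaps r n) (λ f → ∑ (allFin n) (λ x → F ((x ◂ f) ⧺ g))))
    ≡⟨ ∑-cong (allMaps d n) (λ g → ∑-allMaps-suc {r} (λ f → F (f ⧺ g))) ⟨
  ∑ (allMaps d n) (λ g → ∑ (allMaps (suc r) n) (λ f → F (f ⧺ g))) ∎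
  where
  open ≡-Reasoning
  F′ : (Fin (r + d) → Fin n) → ℕ
  F′ f = ∑ (allFin n) (λ x → F (x ◂ f))
  assoc : ∀ x (f : Fin r → Fin n) (g : Fin d → Fin n) i → (x ◂ (f ⧺ g)) i ≡ ((x ◂ f) ⧺ g) i
  assoc x f g zero    = refl
  assoc x f g (suc i) with splitAt r i
  ... | inj₁ _ = refl
  ... | inj₂ _ = refl

mix : (Fin k → Bool) → (f g : Fin k → A) → Fin k → A
mix S f g i = if S i then f i else g i

-- Each map arises from exactly `n ^ k` pairs, because `f` outside `S` and `g` inside `S` are free.
-- A sum over independent choices on two sets of coordinates thus stays a sum over full maps.
∑-mix : ∀ k (S : Fin k → Bool) (F : (Fin k → Fin n) → ℕ) → Extensional F →
        n ^ k * ∑ (allMaps k n) F ≡ ∑ (allMaps k n) (λ f → ∑ (allMaps k n) (λ g → F (mix S f g)))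
∑-mix zero S F ext =
  trans (*-identityˡ _) (cong (_+ 0) (trans (ext (λ ())) (sym (+-identityʳ _))))
∑-mix {n} (suc k) S F ext = begin
  n * n ^ k * ∑ (allMaps (suc k) n) F
    ≡⟨ cong (n * n ^ k *_) (∑-allMaps-suc {k} F) ⟩
  n * n ^ k * ∑ M F′
    ≡⟨ *-assoc n (n ^ k) _ ⟩
  n * (n ^ k * ∑ M F′)
    ≡⟨ cong (n *_) (∑-mix k S′ F′ (λ f≗g → ∑-cong (allFin n) (λ x → ext (◂-cong x f≗g)))) ⟩
  n * ∑ M (λ f → ∑ M (λ g → F′ (mix S′ f g)))
    ≡⟨ *-distribˡ-∑ n M _ ⟩
  ∑ M (λ f → n * ∑ M (λ g → F′ (mix S′ f g)))
    ≡⟨ ∑-cong M (λ f → *-distribˡ-∑ n M _) ⟩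
  ∑ M (λ f → ∑ M (λ g → n * F′ (mix S′ f g)))
    ≡⟨ ∑-cong M (λ f → ∑-cong M (λ g → head-sum (S zero) refl f g)) ⟨
  ∑ M (λ f → ∑ M (λ g → ∑ (allFin n) (λ x → ∑ (allFin n) (λ y → F (mix S (x ◂ f) (y ◂ g))))))
    ≡⟨ ∑-cong M (λ f → ∑-swap M (allFin n) _) ⟩
  ∑ M (λ f → ∑ (allFin n) (λ x → ∑ M (λ g → ∑ (allFin n) (λ y → F (mix S (x ◂ f) (y ◂ g))))))
    ≡⟨ ∑-cong M (λ f → ∑-cong (allFin n) (λ x → ∑-allMaps-suc {k} (λ g → F (mix S (x ◂ f) g)))) ⟨
  ∑ M (λ f → ∑ (allFin n) (λ x → ∑ (allMaps (suc k) n) (λ g → F (mix S (x ◂ f) g))))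
    ≡⟨ ∑-allMaps-suc {k} (λ f → ∑ (allMaps (suc k) n) (λ g → F (mix S f g))) ⟨
  ∑ (allMaps (suc k) n) (λ f → ∑ (allMaps (suc k) n) (λ g → F (mix S f g))) ∎
  where
  open ≡-Reasoning
  M = allMaps k n
  S′ : Fin k → Bool
  S′ = S ∘ suc
  F′ : (Fin k → Fin n) → ℕ
  F′ f = ∑ (allFin n) (λ x → F (x ◂ f))
  head-sum : ∀ b → S zero ≡ b → ∀ f g →
             ∑ (allFin n) (λ x → ∑ (allFin n) (λ y → F (mix S (x ◂ f) (y ◂ g)))) ≡ n * F′ (mix S′ f g)
  head-sum true S₀ f g = trans
    (∑-cong (allFin n) (λ x → trans
      (∑-cong (allFin n) (λ y → ext {g = x ◂ mix S′ f g}
        λ { zero → cong (λ b → if b then x else y) S₀ ; (suc i) → refl }))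
      (∑-allFin-const n _)))
    (sym (*-distribˡ-∑ n (allFin n) _))
  head-sum false S₀ f g = trans
    (∑-cong (allFin n) (λ x → ∑-cong (allFin n) (λ y → ext {g = y ◂ mix S′ f g}
        λ { zero → cong (λ b → if b then x else y) S₀ ; (suc i) → refl })))
    (∑-allFin-const n _)

∑-independent : ∀ k (S : Fin k → Bool) (F G : (Fin k → Fin n) → ℕ) →
  (∀ {f g} → (∀ i → S i ≡ true  → f i ≡ g i) → F f ≡ F g) →
  (∀ {f g} → (∀ i → S i ≡ false → f i ≡ g i) → G f ≡ G g) →
  n ^ k * ∑ (allMaps k n) (λ f → F f * G f) ≡ ∑ (allMaps k n) F * ∑ (allMaps k n) G
∑-independent {n} k S F G F-on G-on = begin
  n ^ k * ∑ M (λ f → F f * G f)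
    ≡⟨ ∑-mix k S _ (λ f≗g → cong₂ _*_ (F-on (λ i _ → f≗g i)) (G-on (λ i _ → f≗g i))) ⟩
  ∑ M (λ f → ∑ M (λ g → F (mix S f g) * G (mix S f g)))
    ≡⟨ ∑-cong M (λ f → ∑-cong M (λ g → cong₂ _*_
         (F-on (λ i Sᵢ → cong (λ b → if b then f i else g i) Sᵢ))
         (G-on (λ i Sᵢ → cong (λ b → if b then f i else g i) Sᵢ)))) ⟩
  ∑ M (λ f → ∑ M (λ g → F f * G g))
    ≡⟨ ∑-cong M (λ f → *-distribˡ-∑ (F f) M G) ⟨
  ∑ M (λ f → F f * ∑ M G)
    ≡⟨ *-distribʳ-∑ (∑ M G) M F ⟨
  ∑ M F * ∑ M G ∎
  where
  open ≡-Reasoning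
  M = allMaps k n

∑-cartesianProduct : (xs : List A) (ys : List B) (f : A × B → ℕ) →
                     ∑ (cartesianProduct xs ys) f ≡ ∑ xs (λ x → ∑ ys (λ y → f (x , y)))
∑-cartesianProduct []       ys f = refl
∑-cartesianProduct (x ∷ xs) ys f = trans (∑-++ (map (x ,_) ys) _ f)
  (cong₂ _+_ (∑-map (x ,_) ys f) (∑-cartesianProduct xs ys f))

-- Positivity and weighted geometric means

*-pos⁻¹ : ∀ m {n} → 0 < m * n → 0 < m × 0 < n
*-pos⁻¹ (suc m) {zero}  p rewrite *-zeroʳ m = contradiction p λ ()
*-pos⁻¹ (suc m) {suc n} p = s≤s z≤n , s≤s z≤n

zero-^ : ∀ {m} → 0 < m → 0 ^ m ≡ 0
zero-^ {suc m} _ = refl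

^-pos⁻¹ : ∀ m {n} → 0 < n → 0 < m ^ n → 0 < m
^-pos⁻¹ m {suc n} _ p = proj₁ (*-pos⁻¹ m p)

∏-pos⁻¹ : {xs : List A} (f : A → ℕ) {x : A} → x ∈ xs → 0 < ∏ xs f → 0 < f x
∏-pos⁻¹ f (here refl) p = proj₁ (*-pos⁻¹ (f _) p)
∏-pos⁻¹ {xs = y ∷ _} f (there x∈xs) p = ∏-pos⁻¹ f x∈xs (proj₂ (*-pos⁻¹ (f y) p))

∑-pos : {xs : List A} (f : A → ℕ) {x : A} → x ∈ xs → 0 < f x → 0 < ∑ xs f
∑-pos f (here refl) p = <-≤-trans p (m≤m+n _ _)
∑-pos {xs = y ∷ _} f (there x∈xs) p = <-≤-trans (∑-pos f x∈xs p) (m≤n+m _ (f y))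

^-swap : ∀ m n o → (m ^ n) ^ o ≡ (m ^ o) ^ n
^-swap m n o = trans (^-*-assoc m n o) (trans (cong (m ^_) (*-comm n o)) (sym (^-*-assoc m o n)))

∏-^-∑ : (xs : List A) (w : A → ℕ) (c : ℕ) → ∏ xs (λ x → c ^ w x) ≡ c ^ ∑ xs w
∏-^-∑ []       w c = refl
∏-^-∑ (x ∷ xs) w c = trans (cong (c ^ w x *_) (∏-^-∑ xs w c)) (sym (^-distribˡ-+-* c (w x) _))

-- The exponential of Σ w log f.
geom : List A → (w f : A → ℕ) → ℕ
geom xs w f = ∏ xs (λ x → f x ^ w x)

module _ (xs : List A) (w : A → ℕ) where

  geom-* : ∀ f g → geom xs w (λ x → f x * g x) ≡ geom xs w f * geom xs w g
  geom-* f g = trans (∏-cong xs (λ x → ^-distribʳ-* (f x) (g x) (w x))) (∏-distrib-* xs _ _)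

  geom-^ : ∀ f m → geom xs w (λ x → f x ^ m) ≡ geom xs w f ^ m
  geom-^ f m = trans (∏-cong xs (λ x → ^-swap (f x) m (w x))) (∏-^ xs _ m)

  geom-∏ : (ys : List B) (f : B → A → ℕ) →
           geom xs w (λ x → ∏ ys (λ y → f y x)) ≡ ∏ ys (λ y → geom xs w (f y))
  geom-∏ ys f = trans (∏-cong xs (λ x → sym (∏-^ ys (λ y → f y x) (w x)))) (∏-swap xs ys _)

  -- A point of weight zero contributes an exponent zero, hence the factor 1 whatever the base. Only
  -- the support of `w` matters, which is how junk values disappear.
  geom-cong : ∀ {f g} → (∀ x → 0 < w x → f x ≡ g x) → geom xs w f ≡ geom xs w g
  geom-cong {f} {g} f≗g = ∏-cong xs λ x → go x (w x) refl
    where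
    go : ∀ x m → w x ≡ m → f x ^ m ≡ g x ^ m
    go x zero    _  = refl
    go x (suc m) eq = cong (_^ suc m) (f≗g x (subst (0 <_) (sym eq) (s≤s z≤n)))

  geom-pos : ∀ {f} → (∀ x → 0 < w x → 0 < f x) → 0 < geom xs w f
  geom-pos {f} f>0 = ∏-pos xs λ x → go x (w x) refl
    where
    go : ∀ x m → w x ≡ m → 0 < f x ^ m
    go x zero    _  = s≤s z≤n
    go x (suc m) eq = ^-pos (suc m) (f>0 x (subst (0 <_) (sym eq) (s≤s z≤n)))

-- Here `b` is a reference measure and `v`, `u` are densities with respect to it. Its own
-- contribution occurs on both sides and cancels, since `b` is positive wherever `w` is.
gibbs-relative : (xs : List A) (b v u : A → ℕ) →
  let w = λ x → b x * v x in
  ∑ xs w ^ ∑ xs w * geom xs w u ≤ ∑ xs (λ x → b x * u x) ^ ∑ xs w * geom xs w v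
gibbs-relative xs b v u =
  *-cancelˡ-≤-pos (geom xs w b) (geom-pos xs w (λ x → proj₁ ∘ *-pos⁻¹ (b x))) (begin
    geom xs w b * (W ^ W * geom xs w u)                ≡⟨ eq (geom xs w b) (W ^ W) _ ⟩
    W ^ W * (geom xs w b * geom xs w u)                ≡⟨ cong (W ^ W *_) (geom-* xs w b u) ⟨
    W ^ W * geom xs w (λ x → b x * u x)                ≤⟨ gibbs xs w (λ x → b x * u x) ⟩
    U ^ W * geom xs w w                                ≡⟨ cong (U ^ W *_) (geom-* xs w b v) ⟩
    U ^ W * (geom xs w b * geom xs w v)                ≡⟨ eq (U ^ W) (geom xs w b) _ ⟩
    geom xs w b * (U ^ W * geom xs w v)                ∎)
  where
  open ≤-Reasoning
  w = λ x → b x * v x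
  W = ∑ xs w
  U = ∑ xs (λ x → b x * u x)
  eq : ∀ p q r → p * (q * r) ≡ q * (p * r)
  eq = solve-∀

-- Subsets as Boolean predicates

infixr 8 _⊳_
_⊳_ : Bool → ℕ → ℕ
b ⊳ m = if b then m else 1

count : (Fin k → Bool) → ℕ
count {k} S = countB S (allFin k)

∏-if : (S : A → Bool) (xs : List A) (c e : ℕ) →
       ∏ xs (λ x → if S x then c else e) ≡ c ^ countB S xs * e ^ countB (not ∘ S) xs
∏-if S []       c e = refl
∏-if S (x ∷ xs) c e rewrite ∏-if S xs c e with S x
... | true  = sym (*-assoc c _ _)
... | false = eq e (c ^ countB S xs) (e ^ countB (not ∘ S) xs)
  where
  eq : ∀ e p q → e * (p * q) ≡ p * (e * q)
  eq = solve-∀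

∑-∏-⊳ : (S : Fin k → Bool) (φ : Fin n → ℕ) →
        ∑ (allMaps k n) (λ g → ∏ (allFin k) (λ w → S w ⊳ φ (g w)))
          ≡ ∑ (allFin n) φ ^ count S * n ^ count (not ∘ S)
∑-∏-⊳ {k} {n} S φ = begin
  ∑ (allMaps k n) (λ g → ∏ (allFin k) (λ w → S w ⊳ φ (g w)))
    ≡⟨ ∑-∏-allMaps k (λ w z → S w ⊳ φ z) ⟩
  ∏ (allFin k) (λ w → ∑ (allFin n) (λ z → S w ⊳ φ z))
    ≡⟨ ∏-cong (allFin k) (λ w → cases (S w)) ⟩
  ∏ (allFin k) (λ w → if S w then ∑ (allFin n) φ else n)
    ≡⟨ ∏-if S (allFin k) _ n ⟩
  ∑ (allFin n) φ ^ count S * n ^ count (not ∘ S) ∎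
  where
  open ≡-Reasoning
  cases : ∀ b → ∑ (allFin n) (λ z → b ⊳ φ z) ≡ (if b then ∑ (allFin n) φ else n)
  cases true  = refl
  cases false = trans (∑-allFin-const n 1) (*-identityʳ n)

-- The value at c = 0 is junk; every use is multiplied by c or restricted to c > 0.
cofactor : ℕ → ℕ → ℕ
cofactor n zero    = 1
cofactor n (suc c) = n ! / suc c

-- Every positive c ≤ n divides n!, so one constant clears the denominators of all uniform laws at
-- once, and `cofactor n c` acts as 1/c up to that constant.
*-cofactor : ∀ {n c} → 0 < c → c ≤ n → c * cofactor n c ≡ n !
*-cofactor {n} {suc c} _ c≤n = m*[n/m]≡n (∣-trans (m∣m*n (c !)) (m≤n⇒m!∣n! c≤n))

-- The form that survives c = 0: points without common neighbours only lose mass, which is harmless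
-- in an upper bound for a total.
*-cofactor-≤ : ∀ {n c} → c ≤ n → c * cofactor n c ≤ n !
*-cofactor-≤ {n} {zero}  _   = z≤n
*-cofactor-≤ {n} {suc c} c≤n = ≤-reflexive (*-cofactor (s≤s z≤n) c≤n)

∏-≤1 : (xs : List A) {f : A → ℕ} → (∀ x → f x ≤ 1) → ∏ xs f ≤ 1
∏-≤1 xs f≤1 = ≤-trans (∏-mono-≤ xs f≤1) (≤-reflexive (trans (∏-const xs 1) (^-zeroˡ (length xs))))

⊳-≤1 : ∀ b {m} → m ≤ 1 → b ⊳ m ≤ 1
⊳-≤1 true  m≤1 = m≤1
⊳-≤1 false _   = ≤-refl

∑-allFin-≤ : {f : Fin n → ℕ} → (∀ x → f x ≤ 1) → ∑ (allFin n) f ≤ n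
∑-allFin-≤ {n} f≤1 = ≤-trans (∑-mono-≤ (allFin n) f≤1) (≤-reflexive (trans (∑-allFin-const n 1) (*-identityʳ n)))

count-cong : {S S′ : Fin k → Bool} → (∀ w → S w ≡ S′ w) → count S ≡ count S′
count-cong {k} S≗S′ = ∑-cong (allFin k) (λ w → cong (λ b → if b then 1 else 0) (S≗S′ w))

count-not : (S : Fin k → Bool) → count S + count (not ∘ S) ≡ k
count-not {k} S = begin
  count S + count (not ∘ S)  ≡⟨ ∑-distrib-+ (allFin k) _ _ ⟨
  ∑ (allFin k) (λ w → (if S w then 1 else 0) + (if not (S w) then 1 else 0))
                             ≡⟨ ∑-cong (allFin k) (λ w → cases (S w)) ⟩
  ∑ (allFin k) (λ _ → 1)     ≡⟨ ∑-allFin-const k 1 ⟩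
  k * 1                      ≡⟨ *-identityʳ k ⟩
  k                          ∎
  where
  open ≡-Reasoning
  cases : ∀ b → (if b then 1 else 0) + (if not b then 1 else 0) ≡ 1
  cases true  = refl
  cases false = refl

count-split : (S L : Fin k → Bool) → (∀ w → S w ≡ true → L w ≡ true) →
              count L ≡ count S + count (λ w → L w ∧ not (S w))
count-split {k} S L S⊆L = trans (∑-cong (allFin k) (λ w → cases (S w) (L w) (S⊆L w))) (∑-distrib-+ (allFin k) _ _)
  where
  cases : ∀ s l → (s ≡ true → l ≡ true) →
          (if l then 1 else 0) ≡ (if s then 1 else 0) + (if l ∧ not s then 1 else 0)
  cases true  l     s⇒l rewrite s⇒l refl = refl
  cases false true  _   = refl
  cases false false _   = refl

⊳-* : ∀ b m o → b ⊳ (m * o) ≡ (b ⊳ m) * (b ⊳ o)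
⊳-* true  m o = refl
⊳-* false m o = refl

⊳-∏ : ∀ b (xs : List A) (f : A → ℕ) → b ⊳ ∏ xs f ≡ ∏ xs (λ x → b ⊳ f x)
⊳-∏ true  xs f = refl
⊳-∏ false xs f = sym (trans (∏-const xs 1) (^-zeroˡ (length xs)))

-- Common neighbourhoods

module _ (a : Fin n → Fin n → ℕ) where

  common : (S : Fin k → Bool) → (Fin k → Fin n) → ℕ
  common {k} S g = ∑ (allFin n) (λ z → ∏ (allFin k) (λ w → S w ⊳ a z (g w)))

  codegree : ∀ {r} → (Fin r → Fin n) → ℕ
  codegree {r} x = ∑ (allFin n) (λ z → ∏ (allFin r) (λ i → a (x i) z))

  -- For a 0-1 valued `a`, the indicator that the tuple `x` and the image of `S` under `g` are
  -- completely joined. It factors over the coordinates of `g` and, after exchanging the products,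
  -- over those of `x`, so either argument can be summed out.
  joined : ∀ {r} (S : Fin k → Bool) → (Fin r → Fin n) → (Fin k → Fin n) → ℕ
  joined {k} {r} S x g = ∏ (allFin k) (λ w → S w ⊳ ∏ (allFin r) (λ i → a (x i) (g w)))

  ∑-joined-maps : ∀ {r} (S : Fin k → Bool) (x : Fin r → Fin n) →
                  ∑ (allMaps k n) (joined S x) ≡ codegree x ^ count S * n ^ count (not ∘ S)
  ∑-joined-maps {r = r} S x = ∑-∏-⊳ S (λ z → ∏ (allFin r) (λ i → a (x i) z))

  ∑-joined-tuples : ∀ r (S : Fin k → Bool) (g : Fin k → Fin n) →
                    ∑ (allMaps r n) (λ x → joined S x g) ≡ common S g ^ r
  ∑-joined-tuples {k} r S g = begin
    ∑ (allMaps r n) (λ x → joined S x g)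
      ≡⟨ ∑-cong (allMaps r n) (λ x → trans
           (∏-cong (allFin k) (λ w → ⊳-∏ (S w) (allFin r) _))
           (∏-swap (allFin k) (allFin r) _)) ⟩
    ∑ (allMaps r n) (λ x → ∏ (allFin r) (λ i → ∏ (allFin k) (λ w → S w ⊳ a (x i) (g w))))
      ≡⟨ ∑-∏-allMaps r (λ _ z → ∏ (allFin k) (λ w → S w ⊳ a z (g w))) ⟩
    ∏ (allFin r) (λ _ → common S g)
      ≡⟨ ∏-allFin-const r _ ⟩
    common S g ^ r ∎
    where open ≡-Reasoning

  common-cong : (S : Fin k → Bool) {g h : Fin k → Fin n} →
                (∀ w → S w ≡ true → g w ≡ h w) → common S g ≡ common S h
  common-cong {k} S {g} {h} eq = ∑-cong (allFin n) (λ z → ∏-cong (allFin k) (λ w → cases z w (S w) (eq w)))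
    where
    cases : ∀ z w b → (b ≡ true → g w ≡ h w) → b ⊳ a z (g w) ≡ b ⊳ a z (h w)
    cases z w true  e = cong (a z) (e refl)
    cases z w false e = refl

  joined-cong : ∀ {r} (S : Fin k → Bool) (x : Fin r → Fin n) {g h : Fin k → Fin n} →
                (∀ w → S w ≡ true → g w ≡ h w) → joined S x g ≡ joined S x h
  joined-cong {k} {r} S x {g} {h} eq = ∏-cong (allFin k) (λ w → cases w (S w) (eq w))
    where
    P : Fin n → ℕ
    P z = ∏ (allFin r) (λ i → a (x i) z)
    cases : ∀ w b → (b ≡ true → g w ≡ h w) → b ⊳ P (g w) ≡ b ⊳ P (h w)
    cases w true  e = cong P (e refl)
    cases w false e = refl

  joined-split : ∀ {r} (S L : Fin k → Bool) → (∀ w → S w ≡ true → L w ≡ true) →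
                 (x : Fin r → Fin n) (g : Fin k → Fin n) →
                 joined L x g ≡ joined S x g * joined (λ w → L w ∧ not (S w)) x g
  joined-split {k} {r} S L S⊆L x g =
    trans (∏-cong (allFin k) (λ w → cases (S w) (L w) _ (S⊆L w))) (∏-distrib-* (allFin k) _ _)
    where
    cases : ∀ s l m → (s ≡ true → l ≡ true) → l ⊳ m ≡ (s ⊳ m) * ((l ∧ not s) ⊳ m)
    cases true  l     m s⇒l rewrite s⇒l refl = sym (*-identityʳ m)
    cases false true  m _   = sym (+-identityʳ m)
    cases false false m _   = refl

  -- The entry `x i` is itself a common neighbour of the image of `S`; this is where a nonempty
  -- tuple is needed.
  common-pos : ∀ {r} (S L : Fin k → Bool) → (∀ w → S w ≡ true → L w ≡ true) →
               (x : Fin r → Fin n) (i : Fin r) (g : Fin k → Fin n) →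
               0 < joined L x g → 0 < common S g
  common-pos {k} {r} S L S⊆L x i g p =
    ∑-pos (λ z → ∏ (allFin k) (λ w → S w ⊳ a z (g w))) (∈-allFin (x i))
      (∏-pos (allFin k) (λ w → cases w (S w) (L w) (S⊆L w) (∏-pos⁻¹ _ (∈-allFin w) p)))
    where
    cases : ∀ w s l → (s ≡ true → l ≡ true) →
            0 < l ⊳ ∏ (allFin r) (λ i → a (x i) (g w)) → 0 < s ⊳ a (x i) (g w)
    cases w false l s⇒l q = s≤s z≤n
    cases w true  l s⇒l q rewrite s⇒l refl = ∏-pos⁻¹ (λ i → a (x i) (g w)) (∈-allFin i) q

  module _ (a≤1 : ∀ x z → a x z ≤ 1) where

    common-≤ : (S : Fin k → Bool) (g : Fin k → Fin n) → common S g ≤ n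
    common-≤ {k} S g = ∑-allFin-≤ (λ z → ∏-≤1 (allFin k) (λ w → ⊳-≤1 (S w) (a≤1 z (g w))))

    codegree-≤ : ∀ {r} (x : Fin r → Fin n) → codegree x ≤ n
    codegree-≤ {r} x = ∑-allFin-≤ (λ z → ∏-≤1 (allFin r) (λ i → a≤1 (x i) z))

-- Entropy bounds

module Entropy {n r d k : ℕ} (n>0 : 0 < n) (r>0 : 0 < r) (d>0 : 0 < d)
               (a : Fin n → Fin n → ℕ) (a≤1 : ∀ x z → a x z ≤ 1) (L : Fin k → Bool) where

  X : List (Fin r → Fin n)
  X = allMaps r n

  Y : List (Fin k → Fin n)
  Y = allMaps k n

  Ω : List ((Fin r → Fin n) × (Fin k → Fin n))
  Ω = cartesianProduct X Y

  D N κ T : ℕ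
  D = n !
  N = count L
  κ = count (not ∘ L)
  T = ∑ X (λ x → codegree a x ^ d)

  C E : (Fin r → Fin n) → ℕ
  C = codegree a
  E x = cofactor n (C x)

  -- Up to a constant factor w is the law of (x , g) when x is drawn with density proportional
  -- to C x ^ d and g then maps L independently and uniformly into the common neighbours of x.
  I w : (Fin r → Fin n) × (Fin k → Fin n) → ℕ
  I (x , g) = joined a L x g
  w (x , g) = I (x , g) * (C x ^ d * E x ^ N)

  W : ℕ
  W = ∑ Ω w

  -- For positive `W`, `P f` is exp (W E log f) under the law `w / W`. A constant therefore appears
  -- raised to the power `W` when it is compared with such a mean.
  P : ((Fin r → Fin n) × (Fin k → Fin n) → ℕ) → ℕ
  P = geom Ω w

  p : ℕ
  p = P (C ∘ proj₁)

  D>0 : 0 < D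
  D>0 = >-nonZero⁻¹ D {{n !≢0}}

  I-pos : ∀ ω → 0 < w ω → 0 < I ω
  I-pos ω = proj₁ ∘ *-pos⁻¹ (I ω)

  C-pos : ∀ ω → 0 < w ω → 0 < C (proj₁ ω)
  C-pos (x , g) q = ^-pos⁻¹ (C x) d>0 (proj₁ (*-pos⁻¹ (C x ^ d) (proj₂ (*-pos⁻¹ (I (x , g)) q))))

  p>0 : 0 < p
  p>0 = geom-pos Ω w C-pos

  P-const : ∀ c → P (λ _ → c) ≡ c ^ W
  P-const = ∏-^-∑ Ω w

  P-cofactor : (c : (Fin r → Fin n) × (Fin k → Fin n) → ℕ) →
               (∀ ω → 0 < w ω → 0 < c ω) → (∀ ω → c ω ≤ n) → P c * P (cofactor n ∘ c) ≡ D ^ W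
  P-cofactor c c>0 c≤n = begin
    P c * P (cofactor n ∘ c)            ≡⟨ geom-* Ω w c (cofactor n ∘ c) ⟨
    P (λ ω → c ω * cofactor n (c ω))    ≡⟨ geom-cong Ω w (λ ω q → *-cofactor (c>0 ω q) (c≤n ω)) ⟩
    P (λ _ → D)                         ≡⟨ P-const D ⟩
    D ^ W                               ∎
    where open ≡-Reasoning

  p-cofactor : p * P (E ∘ proj₁) ≡ D ^ W
  p-cofactor = P-cofactor (C ∘ proj₁) C-pos (codegree-≤ a a≤1 ∘ proj₁)

  *-E-^ : ∀ x m → 0 < C x → C x ^ m * E x ^ m ≡ D ^ m
  *-E-^ x m C>0 = trans (sym (^-distribʳ-* (C x) (E x) m)) (cong (_^ m) (*-cofactor C>0 (codegree-≤ a a≤1 x)))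

  -- Summing out `g` gives `C x ^ N * n ^ κ`, and `E x ^ N` turns the first factor into the constant
  -- `D ^ N`. The marginal weight of `x` is thus proportional to `C x ^ d`.
  W≡ : W ≡ n ^ κ * (D ^ N * T)
  W≡ = begin
    ∑ Ω w
      ≡⟨ ∑-cartesianProduct X Y w ⟩
    ∑ X (λ x → ∑ Y (λ g → joined a L x g * (C x ^ d * E x ^ N)))
      ≡⟨ ∑-cong X (λ x → *-distribʳ-∑ (C x ^ d * E x ^ N) Y (joined a L x)) ⟨
    ∑ X (λ x → ∑ Y (joined a L x) * (C x ^ d * E x ^ N))
      ≡⟨ ∑-cong X (λ x → cong (_* (C x ^ d * E x ^ N)) (∑-joined-maps a L x)) ⟩
    ∑ X (λ x → C x ^ N * n ^ κ * (C x ^ d * E x ^ N))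
      ≡⟨ ∑-cong X (λ x → cases x (C x) refl) ⟩
    ∑ X (λ x → n ^ κ * (D ^ N * C x ^ d))
      ≡⟨ *-distribˡ-∑ (n ^ κ) X _ ⟨
    n ^ κ * ∑ X (λ x → D ^ N * C x ^ d)
      ≡⟨ cong (n ^ κ *_) (*-distribˡ-∑ (D ^ N) X _) ⟨
    n ^ κ * (D ^ N * T) ∎
    where
    open ≡-Reasoning
    eq : ∀ p q r s → p * q * (r * s) ≡ q * (p * s * r)
    eq = solve-∀
    cases : ∀ x c → C x ≡ c → C x ^ N * n ^ κ * (C x ^ d * E x ^ N) ≡ n ^ κ * (D ^ N * C x ^ d)
    -- The relation between `C x` and `E x` fails at zero, but the factor `C x ^ d` kills both sides
    -- because `d` is positive.
    cases x zero    Cx≡0 = trans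
      (cong (λ q → C x ^ N * n ^ κ * (q * E x ^ N)) C^d≡0)
      (trans (*-zeroʳ (C x ^ N * n ^ κ)) (sym (trans
        (cong (λ q → n ^ κ * (D ^ N * q)) C^d≡0)
        (trans (cong (n ^ κ *_) (*-zeroʳ (D ^ N))) (*-zeroʳ (n ^ κ))))))
      where
      C^d≡0 : C x ^ d ≡ 0
      C^d≡0 = trans (cong (_^ d) Cx≡0) (zero-^ d>0)
    cases x (suc c) Cx≡c = trans (eq (C x ^ N) (n ^ κ) (C x ^ d) (E x ^ N))
      (cong (λ q → n ^ κ * (q * C x ^ d)) (*-E-^ x N (subst (0 <_) (sym Cx≡c) (s≤s z≤n))))

  -- With U the total of `I ω * u ω` and W positive, this reads κ log n + log T + E log u + (N - d)
  -- E log C ≤ log U. The powers of `E` are eliminated by `p-cofactor`. Each later bound comes from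
  -- a choice of the comparison density `u`.
  entropy-bound : (u : (Fin r → Fin n) × (Fin k → Fin n) → ℕ) →
                  (n ^ κ) ^ W * T ^ W * (P u * p ^ N) ≤ ∑ Ω (λ ω → I ω * u ω) ^ W * p ^ d
  entropy-bound u = *-cancelˡ-≤-pos ((D ^ W) ^ N) (^-pos N (^-pos W D>0)) (begin
    (D ^ W) ^ N * ((n ^ κ) ^ W * T ^ W * (P u * p ^ N))
      ≡⟨ cong (_* ((n ^ κ) ^ W * T ^ W * (P u * p ^ N))) (^-swap D W N) ⟩
    (D ^ N) ^ W * ((n ^ κ) ^ W * T ^ W * (P u * p ^ N))
      ≡⟨ eq₁ ((D ^ N) ^ W) ((n ^ κ) ^ W) (T ^ W) (P u) (p ^ N) ⟩
    (n ^ κ) ^ W * ((D ^ N) ^ W * T ^ W) * P u * p ^ N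
      ≡⟨ cong (λ q → q * P u * p ^ N) W^W ⟨
    W ^ W * P u * p ^ N
      ≤⟨ *-monoˡ-≤ (p ^ N) (gibbs-relative Ω I (λ (x , g) → C x ^ d * E x ^ N) u) ⟩
    U ^ W * P (λ (x , g) → C x ^ d * E x ^ N) * p ^ N
      ≡⟨ cong (λ q → U ^ W * q * p ^ N) (trans (geom-* Ω w _ _) (cong₂ _*_ (geom-^ Ω w _ d) (geom-^ Ω w _ N))) ⟩
    U ^ W * (p ^ d * P (E ∘ proj₁) ^ N) * p ^ N
      ≡⟨ eq₂ (U ^ W) (p ^ d) (P (E ∘ proj₁) ^ N) (p ^ N) ⟩
    p ^ N * P (E ∘ proj₁) ^ N * (U ^ W * p ^ d)
      ≡⟨ cong (_* (U ^ W * p ^ d)) (trans (sym (^-distribʳ-* p _ N)) (cong (_^ N) p-cofactor)) ⟩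
    (D ^ W) ^ N * (U ^ W * p ^ d) ∎)
    where
    open ≤-Reasoning
    U = ∑ Ω (λ ω → I ω * u ω)
    W^W : W ^ W ≡ (n ^ κ) ^ W * ((D ^ N) ^ W * T ^ W)
    W^W = trans (cong (_^ W) W≡) (trans (^-distribʳ-* (n ^ κ) _ W) (cong ((n ^ κ) ^ W *_) (^-distribʳ-* (D ^ N) T W)))
    eq₁ : ∀ a b c e f → a * (b * c * (e * f)) ≡ b * (a * c) * e * f
    eq₁ = solve-∀
    eq₂ : ∀ a b c e → a * (b * c) * e ≡ e * c * (a * b)
    eq₂ = solve-∀

  ν^κ>0 : 0 < (n ^ κ) ^ W
  ν^κ>0 = ^-pos W (^-pos κ n>0)

  -- The comparison law draws `x` uniformly and then `g` as under `w`, so its density is `E x ^ N`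
  -- and the `N` factors `p` cancel. The result is log T ≤ r log n + d E log C.
  codegree-bound : T ^ W ≤ (n ^ W) ^ r * p ^ d
  codegree-bound = *-cancelˡ-≤-pos ((n ^ κ) ^ W * (D ^ W) ^ N) (*-mono-< ν^κ>0 (^-pos N (^-pos W D>0))) (begin
    (n ^ κ) ^ W * (D ^ W) ^ N * T ^ W
      ≡⟨ cong (λ q → (n ^ κ) ^ W * q * T ^ W) (trans (cong (_^ N) (sym p-cofactor)) (^-distribʳ-* p _ N)) ⟩
    (n ^ κ) ^ W * (p ^ N * P (E ∘ proj₁) ^ N) * T ^ W
      ≡⟨ eq₁ ((n ^ κ) ^ W) (p ^ N) (P (E ∘ proj₁) ^ N) (T ^ W) ⟩
    (n ^ κ) ^ W * T ^ W * (P (E ∘ proj₁) ^ N * p ^ N)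
      ≡⟨ cong (λ q → (n ^ κ) ^ W * T ^ W * (q * p ^ N)) (geom-^ Ω w (E ∘ proj₁) N) ⟨
    (n ^ κ) ^ W * T ^ W * (P (λ (x , g) → E x ^ N) * p ^ N)
      ≤⟨ entropy-bound (λ (x , g) → E x ^ N) ⟩
    ∑ Ω (λ (x , g) → joined a L x g * E x ^ N) ^ W * p ^ d
      ≤⟨ *-monoˡ-≤ (p ^ d) (^-monoˡ-≤ W total) ⟩
    (n ^ κ * (D ^ N * n ^ r)) ^ W * p ^ d
      ≡⟨ cong (_* p ^ d) (trans (^-distribʳ-* (n ^ κ) _ W) (cong ((n ^ κ) ^ W *_) (^-distribʳ-* (D ^ N) (n ^ r) W))) ⟩
    (n ^ κ) ^ W * ((D ^ N) ^ W * (n ^ r) ^ W) * p ^ d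
      ≡⟨ cong₂ (λ q q′ → (n ^ κ) ^ W * (q * q′) * p ^ d) (^-swap D N W) (^-swap n r W) ⟩
    (n ^ κ) ^ W * ((D ^ W) ^ N * (n ^ W) ^ r) * p ^ d
      ≡⟨ eq₂ ((n ^ κ) ^ W) ((D ^ W) ^ N) ((n ^ W) ^ r) (p ^ d) ⟩
    (n ^ κ) ^ W * (D ^ W) ^ N * ((n ^ W) ^ r * p ^ d) ∎)
    where
    open ≤-Reasoning
    eq₁ : ∀ a b c e → a * (b * c) * e ≡ a * e * (c * b)
    eq₁ = solve-∀
    eq₂ : ∀ a b c e → a * (b * c) * e ≡ a * b * (c * e)
    eq₂ = solve-∀
    eq₃ : ∀ a b c → a * b * c ≡ b * (a * c)
    eq₃ = solve-∀
    total : ∑ Ω (λ (x , g) → joined a L x g * E x ^ N) ≤ n ^ κ * (D ^ N * n ^ r)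
    total = begin
      ∑ Ω (λ (x , g) → joined a L x g * E x ^ N)
        ≡⟨ ∑-cartesianProduct X Y _ ⟩
      ∑ X (λ x → ∑ Y (λ g → joined a L x g * E x ^ N))
        ≡⟨ ∑-cong X (λ x → *-distribʳ-∑ (E x ^ N) Y (joined a L x)) ⟨
      ∑ X (λ x → ∑ Y (joined a L x) * E x ^ N)
        ≡⟨ ∑-cong X (λ x → trans (cong (_* E x ^ N) (∑-joined-maps a L x)) (eq₃ (C x ^ N) (n ^ κ) (E x ^ N))) ⟩
      ∑ X (λ x → n ^ κ * (C x ^ N * E x ^ N))
        ≡⟨ ∑-cong X (λ x → cong (n ^ κ *_) (^-distribʳ-* (C x) (E x) N)) ⟨
      ∑ X (λ x → n ^ κ * (C x * E x) ^ N)
        ≤⟨ ∑-mono-≤ X (λ x → *-monoʳ-≤ (n ^ κ) (^-monoˡ-≤ N (*-cofactor-≤ (codegree-≤ a a≤1 x)))) ⟩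
      ∑ X (λ _ → n ^ κ * D ^ N)
        ≡⟨ ∑-allMaps-const r n _ ⟩
      n ^ r * (n ^ κ * D ^ N)
        ≡⟨ trans (*-comm (n ^ r) _) (*-assoc (n ^ κ) _ _) ⟩
      n ^ κ * (D ^ N * n ^ r) ∎

  -- Of the `N = d + e + f` factors `p`, the `f` belonging to coordinates of `L` outside `S` cancel
  -- against `E x ^ f`, and `d` cancel against the right side of `entropy-bound`. What remains is
  -- `p ^ e`, while `c′ g ^ r` becomes `q ^ r` on the other side.
  common-bound : (S : Fin k → Bool) → (∀ v → S v ≡ true → L v ≡ true) → ∀ e → count S ≡ d + e →
                 T ^ W * p ^ e ≤ (n ^ W) ^ count S * P (common a S ∘ proj₂) ^ r
  common-bound S S⊆L e s≡d+e = *-cancelˡ-≤-pos ((n ^ κ) ^ W * p ^ d * (Δ ^ r * Δ ^ f)) factor>0 (begin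
    (n ^ κ) ^ W * p ^ d * (Δ ^ r * Δ ^ f) * (T ^ W * p ^ e)
      ≡⟨ cong₂ (λ y z → (n ^ κ) ^ W * p ^ d * (y * z) * (T ^ W * p ^ e)) Δ^r Δ^f ⟩
    (n ^ κ) ^ W * p ^ d * (q ^ r * q′ ^ r * (p ^ f * p′ ^ f)) * (T ^ W * p ^ e)
      ≡⟨ eq₁ ((n ^ κ) ^ W) (p ^ d) (q ^ r) (q′ ^ r) (p ^ f) (p′ ^ f) (T ^ W) (p ^ e) ⟩
    (n ^ κ) ^ W * T ^ W * (q′ ^ r * p′ ^ f * (p ^ d * p ^ e * p ^ f)) * q ^ r
      ≡⟨ cong₂ (λ y z → (n ^ κ) ^ W * T ^ W * (y * z) * q ^ r) Pu p^N ⟨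
    (n ^ κ) ^ W * T ^ W * (P u * p ^ N) * q ^ r
      ≤⟨ *-monoˡ-≤ (q ^ r) (entropy-bound u) ⟩
    ∑ Ω (λ ω → I ω * u ω) ^ W * p ^ d * q ^ r
      ≤⟨ *-monoˡ-≤ (q ^ r) (*-monoˡ-≤ (p ^ d) (^-monoˡ-≤ W total)) ⟩
    (n ^ κ * n ^ s * (D ^ f * D ^ r)) ^ W * p ^ d * q ^ r
      ≡⟨ cong (λ y → y * p ^ d * q ^ r) (trans (^-distribʳ-* (n ^ κ * n ^ s) (D ^ f * D ^ r) W)
           (cong₂ _*_ (^-distribʳ-* (n ^ κ) (n ^ s) W) (^-distribʳ-* (D ^ f) (D ^ r) W))) ⟩
    (n ^ κ) ^ W * (n ^ s) ^ W * ((D ^ f) ^ W * (D ^ r) ^ W) * p ^ d * q ^ r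
      ≡⟨ cong (λ y → (n ^ κ) ^ W * y * ((D ^ f) ^ W * (D ^ r) ^ W) * p ^ d * q ^ r) (^-swap n s W) ⟩
    (n ^ κ) ^ W * (n ^ W) ^ s * ((D ^ f) ^ W * (D ^ r) ^ W) * p ^ d * q ^ r
      ≡⟨ cong₂ (λ y z → (n ^ κ) ^ W * (n ^ W) ^ s * (y * z) * p ^ d * q ^ r) (^-swap D f W) (^-swap D r W) ⟩
    (n ^ κ) ^ W * (n ^ W) ^ s * (Δ ^ f * Δ ^ r) * p ^ d * q ^ r
      ≡⟨ eq₂ ((n ^ κ) ^ W) ((n ^ W) ^ s) (Δ ^ f) (Δ ^ r) (p ^ d) (q ^ r) ⟩
    (n ^ κ) ^ W * p ^ d * (Δ ^ r * Δ ^ f) * ((n ^ W) ^ s * q ^ r) ∎)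
    where
    open ≤-Reasoning
    R : Fin k → Bool
    R v = L v ∧ not (S v)
    s = count S
    f = count R
    Δ = D ^ W
    c c′ : (Fin k → Fin n) → ℕ
    c g = common a S g
    c′ g = cofactor n (c g)
    -- Compares w with drawing g on S uniformly, then x among the tuples joined to g(S),
    -- then the rest of g(L) among the common neighbours of x.
    u : (Fin r → Fin n) × (Fin k → Fin n) → ℕ
    u (x , g) = c′ g ^ r * E x ^ f
    q = P (c ∘ proj₂)
    q′ = P (c′ ∘ proj₂)
    p′ = P (E ∘ proj₁)
    N≡s+f : N ≡ s + f
    N≡s+f = count-split S L S⊆L
    Δ^r : Δ ^ r ≡ q ^ r * q′ ^ r
    Δ^r = trans (cong (_^ r) (sym (P-cofactor (c ∘ proj₂)
            (λ ω → common-pos a S L S⊆L (proj₁ ω) (fromℕ< r>0) (proj₂ ω) ∘ I-pos ω)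
            (common-≤ a a≤1 S ∘ proj₂)))) (^-distribʳ-* q q′ r)
    Δ^f : Δ ^ f ≡ p ^ f * p′ ^ f
    Δ^f = trans (cong (_^ f) (sym p-cofactor)) (^-distribʳ-* p p′ f)
    Pu : P u ≡ q′ ^ r * p′ ^ f
    Pu = trans (geom-* Ω w _ _) (cong₂ _*_ (geom-^ Ω w _ r) (geom-^ Ω w _ f))
    p^N : p ^ N ≡ p ^ d * p ^ e * p ^ f
    p^N = trans (cong (p ^_) N≡s+f) (trans (^-distribˡ-+-* p s f)
            (cong (_* p ^ f) (trans (cong (p ^_) s≡d+e) (^-distribˡ-+-* p d e))))
    factor>0 : 0 < (n ^ κ) ^ W * p ^ d * (Δ ^ r * Δ ^ f)
    factor>0 = *-mono-< (*-mono-< ν^κ>0 (^-pos d p>0))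
                        (*-mono-< (^-pos r (^-pos W D>0)) (^-pos f (^-pos W D>0)))
    eq₁ : ∀ a b c e f g h i → a * b * (c * e * (f * g)) * (h * i) ≡ a * h * (e * g * (b * i * f)) * c
    eq₁ = solve-∀
    eq₂ : ∀ a b c e f g → a * b * (c * e) * f * g ≡ a * f * (e * c) * (b * g)
    eq₂ = solve-∀
    eq₃ : ∀ a b c e → a * b * (c * e) ≡ (c * a) * (b * e)
    eq₃ = solve-∀
    not-R : count (not ∘ R) ≡ κ + s
    not-R = +-cancelʳ-≡ f _ _ (begin-equality
      count (not ∘ R) + f  ≡⟨ +-comm _ f ⟩
      f + count (not ∘ R)  ≡⟨ count-not R ⟩
      k                    ≡⟨ count-not L ⟨
      N + κ                ≡⟨ cong (_+ κ) N≡s+f ⟩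
      s + f + κ            ≡⟨ +-comm _ κ ⟩
      κ + (s + f)          ≡⟨ +-assoc κ s f ⟨
      κ + s + f            ∎)
    S≠R : ∀ v → R v ≡ true → S v ≡ false
    S≠R v Rv with L v | S v
    ... | true | false = refl
    F : (Fin r → Fin n) → (Fin k → Fin n) → ℕ
    F x g = c′ g ^ r * joined a S x g
    -- Summing over `x` first yields exactly `c g ^ r` tuples, which `c′ g ^ r` normalises to at
    -- most `D ^ r` for each `g`.
    ∑F : ∑ X (λ x → ∑ Y (F x)) ≤ n ^ k * D ^ r
    ∑F = begin
      ∑ X (λ x → ∑ Y (F x))
        ≡⟨ ∑-swap X Y F ⟩
      ∑ Y (λ g → ∑ X (λ x → c′ g ^ r * joined a S x g))
        ≡⟨ ∑-cong Y (λ g → *-distribˡ-∑ (c′ g ^ r) X (λ x → joined a S x g)) ⟨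
      ∑ Y (λ g → c′ g ^ r * ∑ X (λ x → joined a S x g))
        ≡⟨ ∑-cong Y (λ g → cong (c′ g ^ r *_) (∑-joined-tuples a r S g)) ⟩
      ∑ Y (λ g → c′ g ^ r * c g ^ r)
        ≡⟨ ∑-cong Y (λ g → trans (*-comm (c′ g ^ r) _) (sym (^-distribʳ-* (c g) (c′ g) r))) ⟩
      ∑ Y (λ g → (c g * c′ g) ^ r)
        ≤⟨ ∑-mono-≤ Y (λ g → ^-monoˡ-≤ r (*-cofactor-≤ (common-≤ a a≤1 S g))) ⟩
      ∑ Y (λ _ → D ^ r)
        ≡⟨ ∑-allMaps-const k n _ ⟩
      n ^ k * D ^ r ∎
    -- For fixed `x` the values of `g` on `S` and on `R` are independent, so `R` can be summed out,
    -- giving `C x ^ f`, which `E x ^ f` normalises. The factor `n ^ k` is the price of expressing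
    -- independence with full maps.
    fibre : ∀ x → n ^ k * ∑ Y (λ g → joined a L x g * u (x , g)) ≤ n ^ κ * n ^ s * D ^ f * ∑ Y (F x)
    fibre x = begin
      n ^ k * ∑ Y (λ g → joined a L x g * (c′ g ^ r * E x ^ f))
        ≡⟨ cong (n ^ k *_) (∑-cong Y (λ g → trans
             (cong (_* (c′ g ^ r * E x ^ f)) (joined-split a S L S⊆L x g))
             (eq₃ (joined a S x g) (joined a R x g) (c′ g ^ r) (E x ^ f)))) ⟩
      n ^ k * ∑ Y (λ g → F x g * (joined a R x g * E x ^ f))
        ≡⟨ ∑-independent k S (F x) (λ g → joined a R x g * E x ^ f)
             (λ eq → cong₂ _*_ (cong (λ m → cofactor n m ^ r) (common-cong a S eq)) (joined-cong a S x eq))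
             (λ eq → cong (_* E x ^ f) (joined-cong a R x (λ v Rv → eq v (S≠R v Rv)))) ⟩
      ∑ Y (F x) * ∑ Y (λ g → joined a R x g * E x ^ f)
        ≡⟨ cong (∑ Y (F x) *_) (*-distribʳ-∑ (E x ^ f) Y (joined a R x)) ⟨
      ∑ Y (F x) * (∑ Y (joined a R x) * E x ^ f)
        ≡⟨ cong (λ y → ∑ Y (F x) * (y * E x ^ f)) (trans (∑-joined-maps a R x) (cong (C x ^ f *_) n^)) ⟩
      ∑ Y (F x) * (C x ^ f * (n ^ κ * n ^ s) * E x ^ f)
        ≡⟨ eq₅ (∑ Y (F x)) (C x ^ f) (n ^ κ * n ^ s) (E x ^ f) ⟩
      n ^ κ * n ^ s * (C x ^ f * E x ^ f) * ∑ Y (F x)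
        ≡⟨ cong (λ y → n ^ κ * n ^ s * y * ∑ Y (F x)) (^-distribʳ-* (C x) (E x) f) ⟨
      n ^ κ * n ^ s * (C x * E x) ^ f * ∑ Y (F x)
        ≤⟨ *-monoˡ-≤ (∑ Y (F x)) (*-monoʳ-≤ (n ^ κ * n ^ s) (^-monoˡ-≤ f (*-cofactor-≤ (codegree-≤ a a≤1 x)))) ⟩
      n ^ κ * n ^ s * D ^ f * ∑ Y (F x) ∎
      where
      n^ : n ^ count (not ∘ R) ≡ n ^ κ * n ^ s
      n^ = trans (cong (n ^_) not-R) (^-distribˡ-+-* n κ s)
      eq₅ : ∀ a b c e → a * (b * c * e) ≡ c * (b * e) * a
      eq₅ = solve-∀
    total : ∑ Ω (λ ω → I ω * u ω) ≤ n ^ κ * n ^ s * (D ^ f * D ^ r)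
    total = *-cancelˡ-≤-pos (n ^ k) (^-pos k n>0) (begin
      n ^ k * ∑ Ω (λ ω → I ω * u ω)
        ≡⟨ cong (n ^ k *_) (∑-cartesianProduct X Y _) ⟩
      n ^ k * ∑ X (λ x → ∑ Y (λ g → joined a L x g * u (x , g)))
        ≡⟨ *-distribˡ-∑ (n ^ k) X _ ⟩
      ∑ X (λ x → n ^ k * ∑ Y (λ g → joined a L x g * u (x , g)))
        ≤⟨ ∑-mono-≤ X fibre ⟩
      ∑ X (λ x → n ^ κ * n ^ s * D ^ f * ∑ Y (F x))
        ≡⟨ *-distribˡ-∑ (n ^ κ * n ^ s * D ^ f) X _ ⟨
      n ^ κ * n ^ s * D ^ f * ∑ X (λ x → ∑ Y (F x))
        ≤⟨ *-monoʳ-≤ (n ^ κ * n ^ s * D ^ f) ∑F ⟩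
      n ^ κ * n ^ s * D ^ f * (n ^ k * D ^ r)
        ≡⟨ eq₆ (n ^ κ * n ^ s) (D ^ f) (n ^ k) (D ^ r) ⟩
      n ^ k * (n ^ κ * n ^ s * (D ^ f * D ^ r)) ∎)
      where
      eq₆ : ∀ a b c e → a * b * (c * e) ≡ c * (a * (b * e))
      eq₆ = solve-∀

-- Eliminating the auxiliary means

-- In logarithms: `e` times the first hypothesis plus `d` times the second, chosen so that the terms
-- d e log p cancel.
vertex-arithmetic : ∀ t ν p q r d e → t ≤ ν ^ r * p ^ d → t * p ^ e ≤ ν ^ (d + e) * q ^ r →
                    t ^ (d + e) * ν ^ (r * d) ≤ q ^ (r * d) * ν ^ ((r + d) * (d + e))
vertex-arithmetic t ν p q r d e h₁ h₂ = begin
  t ^ (d + e) * ν ^ (r * d)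
    ≡⟨ cong (_* ν ^ (r * d)) (^-distribˡ-+-* t d e) ⟩
  t ^ d * t ^ e * ν ^ (r * d)
    ≤⟨ *-monoˡ-≤ (ν ^ (r * d)) (*-monoʳ-≤ (t ^ d) (^-monoˡ-≤ e h₁)) ⟩
  t ^ d * (ν ^ r * p ^ d) ^ e * ν ^ (r * d)
    ≡⟨ cong (λ y → t ^ d * y * ν ^ (r * d)) (trans (^-distribʳ-* (ν ^ r) (p ^ d) e) (cong₂ _*_ (^-*-assoc ν r e) (^-swap p d e))) ⟩
  t ^ d * (ν ^ (r * e) * (p ^ e) ^ d) * ν ^ (r * d)
    ≡⟨ eq₁ (t ^ d) (ν ^ (r * e)) ((p ^ e) ^ d) (ν ^ (r * d)) ⟩
  t ^ d * (p ^ e) ^ d * (ν ^ (r * e) * ν ^ (r * d))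
    ≡⟨ cong (_* (ν ^ (r * e) * ν ^ (r * d))) (^-distribʳ-* t (p ^ e) d) ⟨
  (t * p ^ e) ^ d * (ν ^ (r * e) * ν ^ (r * d))
    ≤⟨ *-monoˡ-≤ _ (^-monoˡ-≤ d h₂) ⟩
  (ν ^ (d + e) * q ^ r) ^ d * (ν ^ (r * e) * ν ^ (r * d))
    ≡⟨ cong (_* (ν ^ (r * e) * ν ^ (r * d))) (trans (^-distribʳ-* (ν ^ (d + e)) (q ^ r) d)
         (cong₂ _*_ (^-*-assoc ν (d + e) d) (^-*-assoc q r d))) ⟩
  ν ^ ((d + e) * d) * q ^ (r * d) * (ν ^ (r * e) * ν ^ (r * d))
    ≡⟨ eq₂ (ν ^ ((d + e) * d)) (q ^ (r * d)) (ν ^ (r * e)) (ν ^ (r * d)) ⟩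
  q ^ (r * d) * (ν ^ ((d + e) * d) * (ν ^ (r * e) * ν ^ (r * d)))
    ≡⟨ cong (λ y → q ^ (r * d) * (ν ^ ((d + e) * d) * y)) (^-distribˡ-+-* ν (r * e) (r * d)) ⟨
  q ^ (r * d) * (ν ^ ((d + e) * d) * ν ^ (r * e + r * d))
    ≡⟨ cong (q ^ (r * d) *_) (^-distribˡ-+-* ν ((d + e) * d) _) ⟨
  q ^ (r * d) * ν ^ ((d + e) * d + (r * e + r * d))
    ≡⟨ cong (λ y → q ^ (r * d) * ν ^ y) (eq₃ r d e) ⟩
  q ^ (r * d) * ν ^ ((r + d) * (d + e)) ∎
  where
  open ≤-Reasoning
  eq₁ : ∀ a b c e → a * (b * c) * e ≡ a * c * (b * e)
  eq₁ = solve-∀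
  eq₂ : ∀ a b c e → a * b * (c * e) ≡ b * (a * (c * e))
  eq₂ = solve-∀
  eq₃ : ∀ r d e → (d + e) * d + (r * e + r * d) ≡ (r + d) * (d + e)
  eq₃ = solve-∀

-- In logarithms: `r * e` times the first hypothesis, `r * d` times the second and the third once.
-- The terms in log p and log Q cancel, and log t collects the coefficient rd + re + σ.
total-arithmetic : ∀ t ν p Q η r d e κ l σ → t ≤ ν ^ r * p ^ d → ν ^ κ * t * (Q * p ^ e) ≤ η →
                   t ^ σ * ν ^ (r * d * l) ≤ Q ^ (r * d) * ν ^ ((r + d) * σ) →
                   t ^ (r * (d + e) + σ) * ν ^ (r * d * (κ + (d + e) + (l + r)))
                     ≤ η ^ (r * d) * ν ^ ((r + d) * (r * (d + e) + σ))
total-arithmetic t ν p Q η r d e κ l σ h₁ h₂ h₃ = begin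
  t ^ (r * (d + e) + σ) * ν ^ (r * d * (κ + (d + e) + (l + r)))
    ≡⟨ cong₂ (λ y z → t ^ y * ν ^ z) (eq₁ r d e σ) (eq₂ r d e κ l) ⟩
  t ^ (r * d + (r * e + σ)) * ν ^ (κ * (r * d) + (r * d * l + r * d * ((d + e) + r)))
    ≡⟨ cong₂ _*_ (trans (^-distribˡ-+-* t (r * d) _) (cong (t ^ (r * d) *_) (^-distribˡ-+-* t (r * e) σ)))
                 (trans (^-distribˡ-+-* ν (κ * (r * d)) _) (cong (ν ^ (κ * (r * d)) *_) (^-distribˡ-+-* ν (r * d * l) _))) ⟩
  t ^ (r * d) * (t ^ (r * e) * t ^ σ) * (ν ^ (κ * (r * d)) * (ν ^ (r * d * l) * ν′))
    ≡⟨ eq₃ (t ^ (r * d)) (t ^ (r * e)) (t ^ σ) (ν ^ (κ * (r * d))) (ν ^ (r * d * l)) ν′ ⟩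
  ν ^ (κ * (r * d)) * t ^ (r * d) * ν′ * (t ^ (r * e) * (t ^ σ * ν ^ (r * d * l)))
    ≤⟨ *-monoʳ-≤ (ν ^ (κ * (r * d)) * t ^ (r * d) * ν′) (*-mono-≤ (^-monoˡ-≤ (r * e) h₁) h₃) ⟩
  ν ^ (κ * (r * d)) * t ^ (r * d) * ν′ * ((ν ^ r * p ^ d) ^ (r * e) * (Q ^ (r * d) * ν ^ ((r + d) * σ)))
    ≡⟨ cong (λ y → ν ^ (κ * (r * d)) * t ^ (r * d) * ν′ * (y * (Q ^ (r * d) * ν ^ ((r + d) * σ))))
         (trans (^-distribʳ-* (ν ^ r) (p ^ d) (r * e)) (cong₂ _*_ (^-*-assoc ν r (r * e))
           (trans (^-*-assoc p d (r * e)) (trans (cong (p ^_) (eq₄ r d e)) (sym (^-*-assoc p e (r * d))))))) ⟩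
  ν ^ (κ * (r * d)) * t ^ (r * d) * ν′ * (ν ^ (r * (r * e)) * (p ^ e) ^ (r * d) * (Q ^ (r * d) * ν ^ ((r + d) * σ)))
    ≡⟨ eq₅ (ν ^ (κ * (r * d))) (t ^ (r * d)) ν′ (ν ^ (r * (r * e))) ((p ^ e) ^ (r * d)) (Q ^ (r * d)) (ν ^ ((r + d) * σ)) ⟩
  ν ^ (κ * (r * d)) * t ^ (r * d) * (Q ^ (r * d) * (p ^ e) ^ (r * d)) * (ν′ * (ν ^ (r * (r * e)) * ν ^ ((r + d) * σ)))
    ≡⟨ cong₂ _*_ power exponent ⟩
  (ν ^ κ * t * (Q * p ^ e)) ^ (r * d) * ν ^ ((r + d) * (r * (d + e) + σ))
    ≤⟨ *-monoˡ-≤ _ (^-monoˡ-≤ (r * d) h₂) ⟩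
  η ^ (r * d) * ν ^ ((r + d) * (r * (d + e) + σ)) ∎
  where
  open ≤-Reasoning
  ν′ = ν ^ (r * d * ((d + e) + r))
  eq₁ : ∀ r d e σ → r * (d + e) + σ ≡ r * d + (r * e + σ)
  eq₁ = solve-∀
  eq₂ : ∀ r d e κ l → r * d * (κ + (d + e) + (l + r)) ≡ κ * (r * d) + (r * d * l + r * d * ((d + e) + r))
  eq₂ = solve-∀
  eq₃ : ∀ a b c e f g → a * (b * c) * (e * (f * g)) ≡ e * a * g * (b * (c * f))
  eq₃ = solve-∀
  eq₄ : ∀ r d e → d * (r * e) ≡ e * (r * d)
  eq₄ = solve-∀
  eq₅ : ∀ a b c e f g h → a * b * c * (e * f * (g * h)) ≡ a * b * (g * f) * (c * (e * h))
  eq₅ = solve-∀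
  eq₆ : ∀ r d e σ → r * d * ((d + e) + r) + (r * (r * e) + (r + d) * σ) ≡ (r + d) * (r * (d + e) + σ)
  eq₆ = solve-∀
  power : ν ^ (κ * (r * d)) * t ^ (r * d) * (Q ^ (r * d) * (p ^ e) ^ (r * d)) ≡ (ν ^ κ * t * (Q * p ^ e)) ^ (r * d)
  power = sym (trans (^-distribʳ-* (ν ^ κ * t) (Q * p ^ e) (r * d))
    (cong₂ _*_ (trans (^-distribʳ-* (ν ^ κ) t (r * d)) (cong (_* t ^ (r * d)) (^-*-assoc ν κ (r * d))))
               (^-distribʳ-* Q (p ^ e) (r * d))))
  exponent : ν′ * (ν ^ (r * (r * e)) * ν ^ ((r + d) * σ)) ≡ ν ^ ((r + d) * (r * (d + e) + σ))
  exponent = trans (cong (ν′ *_) (sym (^-distribˡ-+-* ν (r * (r * e)) _)))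
    (trans (sym (^-distribˡ-+-* ν (r * d * ((d + e) + r)) _)) (cong (ν ^_) (eq₆ r d e σ)))

-- The counting inequality

module Counting {n r d k : ℕ} (n>0 : 0 < n) (r>0 : 0 < r) (d>0 : 0 < d)
         (a : Fin n → Fin n → ℕ) (a≤1 : ∀ x z → a x z ≤ 1) (L : Fin k → Bool) where

  open Entropy n>0 r>0 d>0 a a≤1 L

  -- The second alternative serves the vertices of V₂, which keep a place in the product with an
  -- empty set `S`. All n vertices are then common neighbours and the bound is an equality.
  vertex-bound : (S : Fin k → Bool) →
                 ((∀ v → S v ≡ true → L v ≡ true) × d ≤ count S) ⊎ (∀ v → S v ≡ false) →
                 (T ^ W) ^ count S * (n ^ W) ^ (r * d)
                   ≤ P (common a S ∘ proj₂) ^ (r * d) * (n ^ W) ^ ((r + d) * count S)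
  vertex-bound S (inj₁ (S⊆L , d≤s)) =
    subst (λ s → (T ^ W) ^ s * (n ^ W) ^ (r * d) ≤ P (common a S ∘ proj₂) ^ (r * d) * (n ^ W) ^ ((r + d) * s))
      (sym s≡d+e)
      (vertex-arithmetic (T ^ W) (n ^ W) p (P (common a S ∘ proj₂)) r d e codegree-bound
        (subst (λ s → T ^ W * p ^ e ≤ (n ^ W) ^ s * P (common a S ∘ proj₂) ^ r) s≡d+e
          (common-bound S S⊆L e s≡d+e)))
    where
    e = count S ∸ d
    s≡d+e : count S ≡ d + e
    s≡d+e = sym (m+[n∸m]≡n d≤s)
  vertex-bound S (inj₂ S≡∅) = ≤-reflexive (begin
    (T ^ W) ^ count S * (n ^ W) ^ (r * d)
      ≡⟨ cong (λ s → (T ^ W) ^ s * (n ^ W) ^ (r * d)) s≡0 ⟩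
    1 * (n ^ W) ^ (r * d)
      ≡⟨ *-comm 1 _ ⟩
    (n ^ W) ^ (r * d) * 1
      ≡⟨ cong (λ y → y ^ (r * d) * 1) q≡ν ⟨
    P (common a S ∘ proj₂) ^ (r * d) * 1
      ≡⟨ cong (λ y → P (common a S ∘ proj₂) ^ (r * d) * (n ^ W) ^ y) (trans (cong ((r + d) *_) s≡0) (*-zeroʳ (r + d))) ⟨
    P (common a S ∘ proj₂) ^ (r * d) * (n ^ W) ^ ((r + d) * count S) ∎)
    where
    open ≡-Reasoning
    s≡0 : count S ≡ 0
    s≡0 = trans (count-cong S≡∅) (trans (∑-allFin-const k 0) (*-zeroʳ k))
    common≡n : ∀ g → common a S g ≡ n
    common≡n g = trans
      (∑-cong (allFin n) (λ z → trans (∏-cong (allFin k) (λ v → cong (_⊳ a z (g v)) (S≡∅ v)))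
                                      (trans (∏-const (allFin k) 1) (^-zeroˡ (length (allFin k))))))
      (trans (∑-allFin-const n 1) (*-identityʳ n))
    q≡ν : P (common a S ∘ proj₂) ≡ n ^ W
    q≡ν = trans (geom-cong Ω w (λ ω _ → common≡n (proj₂ ω))) (P-const n)

  module Total (S : A → Fin k → Bool) (js : List A)
           (S-large : ∀ v → ((∀ u → S v u ≡ true → L u ≡ true) × d ≤ count (S v)) ⊎ (∀ u → S v u ≡ false)) where

    σ U : ℕ
    σ = ∑ js (λ v → count (S v))
    U = ∑ Y (λ g → common a L g ^ r * ∏ js (λ v → common a (S v) g))

    Q : ℕ
    Q = ∏ js (λ v → P (common a (S v) ∘ proj₂))

    product-bound : (T ^ W) ^ σ * (n ^ W) ^ (r * d * length js) ≤ Q ^ (r * d) * (n ^ W) ^ ((r + d) * σ)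
    product-bound = begin
      (T ^ W) ^ σ * (n ^ W) ^ (r * d * length js)
        ≡⟨ cong₂ _*_ (sym (∏-^-∑ js (λ v → count (S v)) (T ^ W)))
                     (trans (sym (^-*-assoc (n ^ W) (r * d) _)) (sym (∏-const js _))) ⟩
      ∏ js (λ v → (T ^ W) ^ count (S v)) * ∏ js (λ _ → (n ^ W) ^ (r * d))
        ≡⟨ ∏-distrib-* js _ _ ⟨
      ∏ js (λ v → (T ^ W) ^ count (S v) * (n ^ W) ^ (r * d))
        ≤⟨ ∏-mono-≤ js (λ v → vertex-bound (S v) (S-large v)) ⟩
      ∏ js (λ v → P (common a (S v) ∘ proj₂) ^ (r * d) * (n ^ W) ^ ((r + d) * count (S v)))
        ≡⟨ ∏-distrib-* js _ _ ⟩
      ∏ js (λ v → P (common a (S v) ∘ proj₂) ^ (r * d)) * ∏ js (λ v → (n ^ W) ^ ((r + d) * count (S v)))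
        ≡⟨ cong₂ _*_ (∏-^ js _ (r * d)) (trans (∏-^-∑ js (λ v → (r + d) * count (S v)) (n ^ W))
             (cong ((n ^ W) ^_) (sym (*-distribˡ-∑ (r + d) js _)))) ⟩
      Q ^ (r * d) * (n ^ W) ^ ((r + d) * σ) ∎
      where open ≤-Reasoning

    -- The Jensen step: `u` is the number of ways to extend `g` to the vertices in `js`, and summing
    -- out the tuple `x` supplies the `r` factors `common a L g`. Its geometric mean is `Q`.
    total-bound : ∀ e → N ≡ d + e → (n ^ W) ^ κ * T ^ W * (Q * p ^ e) ≤ U ^ W
    total-bound e N≡d+e = *-cancelˡ-≤-pos (p ^ d) (^-pos d p>0) (begin
      p ^ d * ((n ^ W) ^ κ * T ^ W * (Q * p ^ e))
        ≡⟨ eq (p ^ d) ((n ^ W) ^ κ) (T ^ W) Q (p ^ e) ⟩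
      (n ^ W) ^ κ * T ^ W * (Q * (p ^ d * p ^ e))
        ≡⟨ cong₂ (λ y z → y * T ^ W * (Q * z)) (^-swap n W κ) (trans (sym (^-distribˡ-+-* p d e)) (cong (p ^_) (sym N≡d+e))) ⟩
      (n ^ κ) ^ W * T ^ W * (Q * p ^ N)
        ≡⟨ cong (λ y → (n ^ κ) ^ W * T ^ W * (y * p ^ N)) (geom-∏ Ω w js (λ v → common a (S v) ∘ proj₂)) ⟨
      (n ^ κ) ^ W * T ^ W * (P u * p ^ N)
        ≤⟨ entropy-bound u ⟩
      ∑ Ω (λ ω → I ω * u ω) ^ W * p ^ d
        ≡⟨ cong (λ y → y ^ W * p ^ d) U≡ ⟩
      U ^ W * p ^ d
        ≡⟨ *-comm _ (p ^ d) ⟩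
      p ^ d * U ^ W ∎)
      where
      open ≤-Reasoning
      eq : ∀ a b c e f → a * (b * c * (e * f)) ≡ b * c * (e * (a * f))
      eq = solve-∀
      c : (Fin k → Fin n) → ℕ
      c g = ∏ js (λ v → common a (S v) g)
      u : (Fin r → Fin n) × (Fin k → Fin n) → ℕ
      u = c ∘ proj₂
      U≡ : ∑ Ω (λ ω → I ω * u ω) ≡ U
      U≡ = begin-equality
        ∑ Ω (λ ω → I ω * u ω)                               ≡⟨ ∑-cartesianProduct X Y _ ⟩
        ∑ X (λ x → ∑ Y (λ g → joined a L x g * c g))        ≡⟨ ∑-swap X Y _ ⟩
        ∑ Y (λ g → ∑ X (λ x → joined a L x g * c g))        ≡⟨ ∑-cong Y (λ g → *-distribʳ-∑ (c g) X _) ⟨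
        ∑ Y (λ g → ∑ X (λ x → joined a L x g) * c g)        ≡⟨ ∑-cong Y (λ g → cong (_* c g) (∑-joined-tuples a r L g)) ⟩
        U                                                   ∎

    -- The exponent of n counts the `k` coordinates of `g` and the `length js + r` vertices to which
    -- `g` is extended.
    counting-bound : d ≤ N →
      T ^ (r * N + σ) * n ^ (r * d * (k + (length js + r))) ≤ U ^ (r * d) * n ^ ((r + d) * (r * N + σ))
    counting-bound d≤N with T in T≡
    -- If `T` is zero then so is `W`, and no root can be taken; but the exponent of `T` is at least
    -- `r * N`, hence positive, so the left side vanishes.
    ... | zero rewrite zero-^ (<-≤-trans (*-mono-< r>0 (<-≤-trans d>0 d≤N)) (m≤m+n _ σ)) = z≤n
    -- Positive `T` makes `W` positive, so the inequality between the means may be proved at the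
    -- power `W`.
    ... | suc _ = subst (λ T → T ^ m * n ^ x ≤ U ^ (r * d) * n ^ y) T≡ (^-cancelʳ-≤ W W>0 (begin
      (T ^ m * n ^ x) ^ W
        ≡⟨ trans (^-distribʳ-* (T ^ m) (n ^ x) W) (cong₂ _*_ (^-swap T m W) (^-swap n x W)) ⟩
      (T ^ W) ^ m * (n ^ W) ^ x
        ≡⟨ cong₂ (λ N k → (T ^ W) ^ (r * N + σ) * (n ^ W) ^ (r * d * (k + (length js + r)))) N≡d+e
             (trans (sym (count-not L)) (trans (+-comm N κ) (cong (κ +_) N≡d+e))) ⟩
      (T ^ W) ^ (r * (d + e) + σ) * (n ^ W) ^ (r * d * (κ + (d + e) + (length js + r)))
        ≤⟨ total-arithmetic (T ^ W) (n ^ W) p Q (U ^ W) r d e κ (length js) σ codegree-bound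
             (total-bound e N≡d+e) product-bound ⟩
      (U ^ W) ^ (r * d) * (n ^ W) ^ ((r + d) * (r * (d + e) + σ))
        ≡⟨ cong (λ N → (U ^ W) ^ (r * d) * (n ^ W) ^ ((r + d) * (r * N + σ))) N≡d+e ⟨
      (U ^ W) ^ (r * d) * (n ^ W) ^ y
        ≡⟨ trans (^-distribʳ-* (U ^ (r * d)) (n ^ y) W) (cong₂ _*_ (^-swap U (r * d) W) (^-swap n y W)) ⟨
      (U ^ (r * d) * n ^ y) ^ W ∎))
      where
      open ≤-Reasoning
      m = r * N + σ
      x = r * d * (k + (length js + r))
      y = (r + d) * m
      e = N ∸ d
      N≡d+e : N ≡ d + e
      N≡d+e = sym (m+[n∸m]≡n d≤N)
      W>0 : 0 < W
      W>0 = subst (0 <_) (sym W≡) (*-mono-< (^-pos κ n>0) (*-mono-< (^-pos N D>0)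
              (subst (0 <_) (sym T≡) (s≤s z≤n))))

-- Graphs and densities

-- Serves to split the vertex list into the `r` complete vertices and the rest, so that sums and
-- products over all vertices split accordingly.
Unique-⊆⇒↭ : (xs ys : List A) → Unique xs → (∀ {x} → x ∈ xs → x ∈ ys) → ∃ λ zs → ys ↭ xs ++ zs
Unique-⊆⇒↭ []       ys _ _ = ys , ↭-refl
Unique-⊆⇒↭ (x ∷ xs) ys (x∉xs ∷ xs!) xs⊆ys with ∈-∃++ (xs⊆ys (here refl))
... | as , bs , refl = let zs , p = Unique-⊆⇒↭ xs (as ++ bs) xs! remains in
                       zs , ↭-trans (shift x as bs) (prep x p)
  where
  remains : ∀ {y} → y ∈ xs → y ∈ as ++ bs
  remains y∈xs with ∈-resp-↭ (shift x as bs) (xs⊆ys (there y∈xs))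
  ... | here refl = contradiction refl (All.lookup x∉xs y∈xs)
  ... | there y∈  = y∈

-- Comparing powers of fractions

toℚᵘ-/ : ∀ i q .{{_ : NonZero q}} → ℚ.toℚᵘ (i ℚ./ q) ℚᵘ.≃ i ℚᵘ./ q
toℚᵘ-/ i (suc q) = ℚ.toℚᵘ-fromℚᵘ (ℚᵘ.mkℚᵘ i q)

/-*-/ : ∀ i j b c .{{_ : NonZero b}} .{{_ : NonZero c}} →
        (i ℚᵘ./ b) ℚᵘ.* (j ℚᵘ./ c) ≡ ((i ℤ.* j) ℚᵘ./ (b * c)) {{m*n≢0 b c}}
/-*-/ i j (suc b) (suc c) = refl

-- Division in `ℚ` reduces to lowest terms, which hides numerator and denominator of a power. In the
-- unnormalised rationals they are simply the powers `p ^ e` and `q ^ e`.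
toℚᵘ-^ℚ : ∀ p q .{{_ : NonZero q}} e →
          ℚ.toℚᵘ (((ℤ.+ p) ℚ./ q) ^ℚ e) ℚᵘ.≃ ((ℤ.+ (p ^ e)) ℚᵘ./ (q ^ e)) {{m^n≢0 q e}}
toℚᵘ-^ℚ p q zero    = ℚᵘ.≃-refl
toℚᵘ-^ℚ p q (suc e) = begin
  ℚ.toℚᵘ (x ℚ.* (x ^ℚ e))                   ≈⟨ ℚ.toℚᵘ-homo-* x (x ^ℚ e) ⟩
  ℚ.toℚᵘ x ℚᵘ.* ℚ.toℚᵘ (x ^ℚ e)             ≈⟨ ℚᵘ.*-cong (toℚᵘ-/ (ℤ.+ p) q) (toℚᵘ-^ℚ p q e) ⟩
  ((ℤ.+ p) ℚᵘ./ q) ℚᵘ.* ((ℤ.+ (p ^ e)) ℚᵘ./ (q ^ e))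
                                            ≡⟨ /-*-/ (ℤ.+ p) (ℤ.+ (p ^ e)) q (q ^ e) ⟩
  ((ℤ.+ p ℤ.* ℤ.+ (p ^ e)) ℚᵘ./ (q ^ suc e))    ≡⟨ cong (λ i → i ℚᵘ./ (q ^ suc e)) (sym (ℤ.pos-* p (p ^ e))) ⟩
  ((ℤ.+ (p ^ suc e)) ℚᵘ./ (q ^ suc e))        ∎
  where
  open ℚᵘ.≃-Reasoning
  x = (ℤ.+ p) ℚ./ q
  instance
    _ = m^n≢0 q e
    _ = m^n≢0 q (suc e)

/-mono-≤ : ∀ i j b c .{{_ : NonZero b}} .{{_ : NonZero c}} → i * c ≤ j * b → (ℤ.+ i) ℚᵘ./ b ℚᵘ.≤ (ℤ.+ j) ℚᵘ./ c
/-mono-≤ i j (suc b) (suc c) le = ℚᵘ.*≤* (subst₂ ℤ._≤_ (ℤ.pos-* i (suc c)) (ℤ.pos-* j (suc b)) (ℤ.+≤+ le))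

^ℚ-mono-≤ : ∀ p q .{{_ : NonZero q}} m p′ q′ .{{_ : NonZero q′}} m′ →
            p ^ m * (q′ ^ m′) ≤ p′ ^ m′ * (q ^ m) →
            (((ℤ.+ p) ℚ./ q) ^ℚ m) ℚ.≤ (((ℤ.+ p′) ℚ./ q′) ^ℚ m′)
^ℚ-mono-≤ p q m p′ q′ m′ le = ℚ.toℚᵘ-cancel-≤
  (ℚᵘ.≤-respˡ-≃ (ℚᵘ.≃-sym (toℚᵘ-^ℚ p q m))
    (ℚᵘ.≤-respʳ-≃ (ℚᵘ.≃-sym (toℚᵘ-^ℚ p′ q′ m′))
      (/-mono-≤ (p ^ m) (p′ ^ m′) (q ^ m) (q′ ^ m′) {{m^n≢0 q m}} {{m^n≢0 q′ m′}} le)))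

allB-true : (p : A → Bool) {xs : List A} {x : A} → x ∈ xs → allB p xs ≡ true → p x ≡ true
allB-true p {y ∷ _} x∈ eq with p y in py
allB-true p (here refl) eq  | true = py
allB-true p (there x∈xs) eq | true = allB-true p x∈xs eq

allB-false : (p : A → Bool) (xs : List A) → allB p xs ≡ false → ∃ λ x → p x ≡ false
allB-false p (x ∷ xs) eq with p x in px
... | true  = allB-false p xs eq
... | false = x , px

<ᵇ-true : ∀ {m o} → m < o → (m <ᵇ o) ≡ true
<ᵇ-true m<o = Equivalence.to T-≡ (<⇒<ᵇ m<o)

<ᵇ-false : ∀ m o → (m + o <ᵇ m) ≡ false
<ᵇ-false zero    o = refl
<ᵇ-false (suc m) o = <ᵇ-false m o

<ᵇ-flip : ∀ m o → m ≢ o → (o <ᵇ m) ≡ not (m <ᵇ o)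
<ᵇ-flip zero    zero    m≢o = contradiction refl m≢o
<ᵇ-flip zero    (suc o) m≢o = refl
<ᵇ-flip (suc m) zero    m≢o = refl
<ᵇ-flip (suc m) (suc o) m≢o = <ᵇ-flip m o (m≢o ∘ cong suc)

ind : Bool → ℕ
ind b = if b then 1 else 0

ind-≤1 : ∀ b → ind b ≤ 1
ind-≤1 true  = ≤-refl
ind-≤1 false = z≤n

-- Homomorphism counts

module _ (G : Graph n) where

  edge : Fin n → Fin n → ℕ
  edge x y = ind (adj G x y)

  -- The count for `K r d` stands on the smaller side of the theorem, so it suffices that a
  -- homomorphism respects each pair across the parts, taken in one orientation. The `d` vertices of
  -- the second part then choose independently among the common neighbours of the first.
  homCount-K-≤ : ∀ r d → homCount (K r d) G ≤ ∑ (allMaps r n) (λ x → codegree edge x ^ d)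
  homCount-K-≤ r d = begin
    ∑ (allMaps (r + d) n) (λ f → ind (isHom (K r d) G f))
      ≤⟨ ∑-mono-≤ (allMaps (r + d) n) (λ f → bound f) ⟩
    ∑ (allMaps (r + d) n) F
      ≡⟨ ∑-allMaps-++ r d F (λ f≗g → ∏-cong (allFin d) (λ j → ∏-cong (allFin r) (λ i →
           cong₂ edge (f≗g (i ↑ˡ d)) (f≗g (r ↑ʳ j))))) ⟩
    ∑ (allMaps d n) (λ g → ∑ (allMaps r n) (λ f → F (f ⧺ g)))
      ≡⟨ ∑-swap (allMaps d n) (allMaps r n) _ ⟩
    ∑ (allMaps r n) (λ f → ∑ (allMaps d n) (λ g → F (f ⧺ g)))
      ≡⟨ ∑-cong (allMaps r n) (λ f → ∑-cong (allMaps d n) (λ g → ∏-cong (allFin d) (λ j → ∏-cong (allFin r) (λ i →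
           cong₂ edge (lookup-++ˡ f g i) (lookup-++ʳ f g j))))) ⟩
    ∑ (allMaps r n) (λ f → ∑ (allMaps d n) (λ g → ∏ (allFin d) (λ j → ∏ (allFin r) (λ i → edge (f i) (g j)))))
      ≡⟨ ∑-cong (allMaps r n) (λ f → trans
           (∑-∏-allMaps d (λ _ z → ∏ (allFin r) (λ i → edge (f i) z)))
           (∏-allFin-const d _)) ⟩
    ∑ (allMaps r n) (λ x → codegree edge x ^ d) ∎
    where
    open ≤-Reasoning
    F : (Fin (r + d) → Fin n) → ℕ
    F f = ∏ (allFin d) (λ j → ∏ (allFin r) (λ i → edge (f (i ↑ˡ d)) (f (r ↑ʳ j))))
    adj-K : ∀ i j → adj (K r d) (i ↑ˡ d) (r ↑ʳ j) ≡ true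
    adj-K i j rewrite toℕ-↑ˡ i d | toℕ-↑ʳ r j | <ᵇ-true (toℕ<n i) | <ᵇ-false r (toℕ j) = refl
    bound : ∀ f → ind (isHom (K r d) G f) ≤ F f
    bound f with isHom (K r d) G f in hom
    ... | false = z≤n
    ... | true  = ∏-pos (allFin d) (λ j → ∏-pos (allFin r) (λ i → ≤-reflexive (sym (cong ind (edges i j)))))
      where
      edges : ∀ i j → adj G (f (i ↑ˡ d)) (f (r ↑ʳ j)) ≡ true
      edges i j = subst (λ b → not b ∨ adj G (f (i ↑ˡ d)) (f (r ↑ʳ j)) ≡ true) (adj-K i j)
        (allB-true _ (∈-allFin (r ↑ʳ j)) (allB-true _ (∈-allFin (i ↑ˡ d)) hom))

module _ (H : Graph k) (side : Fin k → Bool) (bipartite : ∀ u v → adj H u v ≡ true → side v ≡ not (side u)) where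

  nbrs : Fin k → Fin k → Bool
  nbrs u v = side u ∧ adj H u v

  nbrs-side : ∀ u v → nbrs u v ≡ true → side u ≡ true × side v ≡ false × adj H u v ≡ true
  nbrs-side u v uv with side u in su | adj H u v in auv
  ... | true | true = refl , trans (bipartite u v auv) (cong not su) , refl

  -- One side counts an edge at its endpoint of smaller index, the other at its endpoint in V₁.
  -- Splitting by which of the two lies in V₁ and exchanging the sums passes between them.
  edgeCount-nbrs : edgeCount H ≡ ∑ (allFin k) (λ u → count (nbrs u))
  edgeCount-nbrs = begin
    ∑ V (λ u → ∑ V (λ v → ind (lt u v ∧ adj H u v)))
      ≡⟨ ∑-cong V (λ u → ∑-cong V (λ v → one-side u v)) ⟩
    ∑ V (λ u → ∑ V (λ v → ind (lt u v ∧ nbrs u v) + ind (lt u v ∧ nbrs v u)))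
      ≡⟨ split (λ u v → ind (lt u v ∧ nbrs u v)) (λ u v → ind (lt u v ∧ nbrs v u)) ⟩
    ∑ V (λ u → ∑ V (λ v → ind (lt u v ∧ nbrs u v))) + ∑ V (λ u → ∑ V (λ v → ind (lt u v ∧ nbrs v u)))
      ≡⟨ cong (∑ V (λ u → ∑ V (λ v → ind (lt u v ∧ nbrs u v))) +_) (∑-swap V V _) ⟩
    ∑ V (λ u → ∑ V (λ v → ind (lt u v ∧ nbrs u v))) + ∑ V (λ u → ∑ V (λ v → ind (lt v u ∧ nbrs u v)))
      ≡⟨ split (λ u v → ind (lt u v ∧ nbrs u v)) (λ u v → ind (lt v u ∧ nbrs u v)) ⟨
    ∑ V (λ u → ∑ V (λ v → ind (lt u v ∧ nbrs u v) + ind (lt v u ∧ nbrs u v)))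
      ≡⟨ ∑-cong V (λ u → ∑-cong V (λ v → one-order u v)) ⟩
    ∑ V (λ u → count (nbrs u)) ∎
    where
    open ≡-Reasoning
    V = allFin k
    lt : Fin k → Fin k → Bool
    lt u v = toℕ u <ᵇ toℕ v
    split : (f g : Fin k → Fin k → ℕ) → ∑ V (λ u → ∑ V (λ v → f u v + g u v)) ≡ ∑ V (λ u → ∑ V (f u)) + ∑ V (λ u → ∑ V (g u))
    split f g = trans (∑-cong V (λ u → ∑-distrib-+ V (f u) (g u))) (∑-distrib-+ V _ _)
    one-side : ∀ u v → ind (lt u v ∧ adj H u v) ≡ ind (lt u v ∧ nbrs u v) + ind (lt u v ∧ nbrs v u)
    one-side u v with lt u v
    ... | false = refl
    ... | true rewrite adj-sym H v u with adj H u v in uv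
    ... | true rewrite bipartite u v uv with side u
    ...   | true  = refl
    ...   | false = refl
    one-side u v | true | false with side u | side v
    ...   | true  | true  = refl
    ...   | true  | false = refl
    ...   | false | true  = refl
    ...   | false | false = refl
    distinct : ∀ u v → nbrs u v ≡ true → toℕ u ≢ toℕ v
    distinct u v uv eq with refl ← toℕ-injective eq =
      contradiction (trans (sym (irrefl H u)) (proj₂ (proj₂ (nbrs-side u v uv)))) λ ()
    one-order : ∀ u v → ind (lt u v ∧ nbrs u v) + ind (lt v u ∧ nbrs u v) ≡ ind (nbrs u v)
    one-order u v with nbrs u v in uv
    ... | false = go (lt u v) (lt v u)
      where
      go : ∀ b c → ind (b ∧ false) + ind (c ∧ false) ≡ 0
      go true  true  = refl
      go true  false = refl
      go false true  = refl
      go false false = refl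
    ... | true rewrite <ᵇ-flip (toℕ u) (toℕ v) (distinct u v uv) with lt u v
    ...   | true  = refl
    ...   | false = refl

  -- Here `g` supplies the images of V₂ and a second map `h` those of V₁; `h v` ranges over the
  -- common neighbours of the image of `nbrs v`. The values of `g` on V₁ and of `h` on V₂ are free,
  -- whence the factor `n ^ k`.
  homCount-≥ : (G : Graph n) →
    ∑ (allMaps k n) (λ g → ∏ (allFin k) (λ v → common (edge G) (nbrs v) g)) ≤ n ^ k * homCount H G
  homCount-≥ {n} G = begin
    ∑ Y (λ g → ∏ V (λ v → common (edge G) (nbrs v) g))
      ≡⟨ ∑-cong Y (λ g → ∑-∏-allMaps k (λ v z → ∏ V (λ u → nbrs v u ⊳ edge G z (g u)))) ⟨
    ∑ Y (λ g → ∑ Y (λ h → ∏ V (λ v → ∏ V (λ u → nbrs v u ⊳ edge G (h v) (g u)))))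
      ≡⟨ ∑-cong Y (λ g → ∑-cong Y (λ h → ∏-cong V (λ v → ∏-cong V (λ u → mixed g h v u)))) ⟩
    ∑ Y (λ g → ∑ Y (λ h → F (mix side h g)))
      ≡⟨ ∑-swap Y Y _ ⟩
    ∑ Y (λ h → ∑ Y (λ g → F (mix side h g)))
      ≡⟨ ∑-mix k side F (λ f≗g → ∏-cong V (λ v → ∏-cong V (λ u →
           cong₂ (λ x y → nbrs v u ⊳ edge G x y) (f≗g v) (f≗g u)))) ⟨
    n ^ k * ∑ Y F
      ≤⟨ *-monoʳ-≤ (n ^ k) (∑-mono-≤ Y bound) ⟩
    n ^ k * homCount H G ∎
    where
    open ≤-Reasoning
    V = allFin k
    Y = allMaps k n
    F : (Fin k → Fin n) → ℕ
    F f = ∏ V (λ v → ∏ V (λ u → nbrs v u ⊳ edge G (f v) (f u)))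
    mixed : ∀ (g h : Fin k → Fin n) v u →
            nbrs v u ⊳ edge G (h v) (g u) ≡ nbrs v u ⊳ edge G (mix side h g v) (mix side h g u)
    mixed g h v u with nbrs v u in vu
    ... | false = refl
    ... | true with sv , su , _ ← nbrs-side v u vu rewrite sv | su = refl
    bound : ∀ f → F f ≤ ind (isHom H G f)
    bound f with isHom H G f in hom
    ... | true  = ∏-≤1 V (λ v → ∏-≤1 V (λ u → ⊳-≤1 (nbrs v u) (ind-≤1 (adj G (f v) (f u)))))
    -- A failed homomorphism test yields an edge of `H` sent to a non-edge. Oriented from V₁ to V₂,
    -- it is a zero factor of `F f`.
    ... | false with u , pu ← allB-false _ V hom with v , pv ← allB-false _ V pu =
      ≮⇒≥ (λ pos → oriented (side u) refl pos)
      where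
      missing : ∀ u v → nbrs u v ≡ true → adj G (f u) (f v) ≡ false → 0 < F f → ⊥
      missing u v uv nonadj pos = contradiction
        (subst₂ (λ b c → 0 < b ⊳ ind c) uv nonadj (∏-pos⁻¹ _ (∈-allFin v) (∏-pos⁻¹ _ (∈-allFin u) pos))) λ ()
      H-edge : ∀ {b c} → not b ∨ c ≡ false → b ≡ true × c ≡ false
      H-edge {true} {false} _ = refl , refl
      oriented : ∀ b → side u ≡ b → 0 < F f → ⊥
      oriented true  su pos = missing u v (cong₂ _∧_ su (proj₁ (H-edge pv))) (proj₂ (H-edge pv)) pos
      oriented false su pos = missing v u
        (cong₂ _∧_ (trans (bipartite u v (proj₁ (H-edge pv))) (cong not su)) (trans (adj-sym H v u) (proj₁ (H-edge pv))))
        (trans (adj-sym G (f v) (f u)) (proj₂ (H-edge pv))) pos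

-- From weighted counts to homomorphism counts

homCount-bound : ∀ {r d k n} → 1 ≤ r → 1 ≤ d → (H : Graph k) (side : Fin k → Bool) →
  (∀ u v → adj H u v ≡ true → side v ≡ not (side u)) →
  (ι : Fin r → Fin k) → Injective _≡_ _≡_ ι →
  (∀ i → side (ι i) ≡ true × (∀ w → side w ≡ false → adj H (ι i) w ≡ true)) →
  (∀ u → side u ≡ true → d ≤ degree H u) → 0 < n → (G : Graph n) →
  homCount (K r d) G ^ edgeCount H * (n ^ k) ^ (r * d) ≤ homCount H G ^ (r * d) * (n ^ (r + d)) ^ edgeCount H
homCount-bound {r} {d} {k} {n} r≥1 d≥1 H side bipartite ι ι-injective ι-complete deg≥d n>0 G =
    -- The extra factor matches the `n ^ k` in `U≤`, which comes from the free coordinates of the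
    -- two maps.
    (*-cancelˡ-≤-pos ((n ^ k) ^ (r * d)) (^-pos (r * d) (^-pos k n>0)) (begin
      (n ^ k) ^ (r * d) * (homCount (K r d) G ^ m * (n ^ k) ^ (r * d))
        ≤⟨ *-monoʳ-≤ ((n ^ k) ^ (r * d)) (*-monoˡ-≤ _ (^-monoˡ-≤ m (homCount-K-≤ G r d))) ⟩
      (n ^ k) ^ (r * d) * (T ^ m * (n ^ k) ^ (r * d))
        ≡⟨ eq ((n ^ k) ^ (r * d)) (T ^ m) ⟩
      T ^ m * ((n ^ k) ^ (r * d) * (n ^ k) ^ (r * d))
        ≡⟨ cong₂ (λ y z → T ^ y * z) m≡ n^≡ ⟩
      T ^ (r * count L + σ) * n ^ (r * d * (k + (length js + r)))
        ≤⟨ counting-bound d≤N ⟩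
      U ^ (r * d) * n ^ ((r + d) * (r * count L + σ))
        ≤⟨ *-monoˡ-≤ _ (^-monoˡ-≤ (r * d) U≤) ⟩
      (n ^ k * h) ^ (r * d) * n ^ ((r + d) * (r * count L + σ))
        ≡⟨ cong₂ _*_ (^-distribʳ-* (n ^ k) h (r * d))
             (trans (cong (λ y → n ^ ((r + d) * y)) (sym m≡)) (sym (^-*-assoc n (r + d) m))) ⟩
      (n ^ k) ^ (r * d) * h ^ (r * d) * (n ^ (r + d)) ^ m
        ≡⟨ *-assoc ((n ^ k) ^ (r * d)) _ _ ⟩
      (n ^ k) ^ (r * d) * (h ^ (r * d) * (n ^ (r + d)) ^ m) ∎))
  where
  open ≤-Reasoning
  m = edgeCount H
  h = homCount H G
  a = edge G
  S = nbrs H side bipartite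
  L : Fin k → Bool
  L v = not (side v)
  T = ∑ (allMaps r n) (λ x → codegree a x ^ d)

  partition : ∃ λ js → allFin k ↭ map ι (allFin r) ++ js
  partition = Unique-⊆⇒↭ (map ι (allFin r)) (allFin k) (map⁺ ι-injective (allFin⁺ r)) (λ {v} _ → ∈-allFin v)
  js = proj₁ partition

  S-ι : ∀ i v → S (ι i) v ≡ L v
  S-ι i v with side (ι i) in sι | side v in sv
  ... | true  | false = proj₂ (ι-complete i) v sv
  ... | false | _     = contradiction (trans (sym sι) (proj₁ (ι-complete i))) λ ()
  ... | true  | true  with adj H (ι i) v in e
  ...   | false = refl
  ...   | true  = contradiction (trans (sym sv) (trans (bipartite (ι i) v e) (cong not sι))) λ ()

  count-S : ∀ v → side v ≡ true → count (S v) ≡ degree H v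
  count-S v sv = count-cong (λ u → cong (_∧ adj H v u) sv)

  large : ∀ v → ((∀ u → S v u ≡ true → L u ≡ true) × d ≤ count (S v)) ⊎ (∀ u → S v u ≡ false)
  large v = cases (side v) refl
    where
    cases : ∀ b → side v ≡ b → ((∀ u → S v u ≡ true → L u ≡ true) × d ≤ count (S v)) ⊎ (∀ u → S v u ≡ false)
    cases true  sv = inj₁ ((λ u vu → cong not (proj₁ (proj₂ (nbrs-side H side bipartite v u vu)))) ,
                           subst (d ≤_) (sym (count-S v sv)) (deg≥d v sv))
    cases false sv = inj₂ (λ u → cong (_∧ adj H v u) sv)

  open Counting n>0 r≥1 d≥1 a (λ x z → ind-≤1 (adj G x z)) L using (module Total)
  open Total S js large using (σ; U; counting-bound)

  -- The neighbourhood of a complete vertex is all of V₂, so the degree condition at one such vertex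
  -- bounds the size of V₂; it exists because r ≥ 1.
  d≤N : d ≤ count L
  d≤N = subst (d ≤_) (trans (sym (count-S (ι i₀) sι)) (count-cong (S-ι i₀))) (deg≥d (ι i₀) sι)
    where
    i₀ = fromℕ< r≥1
    sι = proj₁ (ι-complete i₀)

  m≡ : m ≡ r * count L + σ
  m≡ = begin-equality
    edgeCount H
      ≡⟨ edgeCount-nbrs H side bipartite ⟩
    ∑ (allFin k) (λ v → count (S v))
      ≡⟨ sum-↭ (↭-map⁺ (λ v → count (S v)) (proj₂ partition)) ⟩
    ∑ (map ι (allFin r) ++ js) (λ v → count (S v))
      ≡⟨ ∑-++ (map ι (allFin r)) js _ ⟩
    ∑ (map ι (allFin r)) (λ v → count (S v)) + σ
      ≡⟨ cong (_+ σ) (trans (∑-map ι (allFin r) _) (trans (∑-cong (allFin r) (λ i → count-cong (S-ι i))) (∑-allFin-const r _))) ⟩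
    r * count L + σ ∎

  length-js : length js + r ≡ k
  length-js = begin-equality
    length js + r                         ≡⟨ +-comm (length js) r ⟩
    r + length js                         ≡⟨ cong (_+ length js) (trans (length-map ι (allFin r)) (length-allFin r)) ⟨
    length (map ι (allFin r)) + length js ≡⟨ length-++ (map ι (allFin r)) ⟨
    length (map ι (allFin r) ++ js)       ≡⟨ ↭-length (proj₂ partition) ⟨
    length (allFin k)                     ≡⟨ length-allFin k ⟩
    k                                     ∎

  n^≡ : (n ^ k) ^ (r * d) * (n ^ k) ^ (r * d) ≡ n ^ (r * d * (k + (length js + r)))
  n^≡ = begin-equality
    (n ^ k) ^ (r * d) * (n ^ k) ^ (r * d)      ≡⟨ ^-distribʳ-* (n ^ k) (n ^ k) (r * d) ⟨
    (n ^ k * n ^ k) ^ (r * d)                  ≡⟨ cong (_^ (r * d)) (^-distribˡ-+-* n k k) ⟨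
    (n ^ (k + k)) ^ (r * d)                    ≡⟨ ^-*-assoc n (k + k) (r * d) ⟩
    n ^ ((k + k) * (r * d))                    ≡⟨ cong (n ^_) (*-comm (k + k) (r * d)) ⟩
    n ^ (r * d * (k + k))                      ≡⟨ cong (λ y → n ^ (r * d * (k + y))) length-js ⟨
    n ^ (r * d * (k + (length js + r)))        ∎

  U≤ : U ≤ n ^ k * h
  U≤ = begin
    U
      ≡⟨ ∑-cong (allMaps k n) (λ g → sym (split g)) ⟩
    ∑ (allMaps k n) (λ g → ∏ (allFin k) (λ v → common a (S v) g))
      ≤⟨ homCount-≥ H side bipartite G ⟩
    n ^ k * h ∎
    where
    common-ι : ∀ g i → common a (S (ι i)) g ≡ common a L g
    common-ι g i = ∑-cong (allFin n) (λ z → ∏-cong (allFin k) (λ w → cong (_⊳ a z (g w)) (S-ι i w)))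
    split : ∀ g → ∏ (allFin k) (λ v → common a (S v) g) ≡ common a L g ^ r * ∏ js (λ v → common a (S v) g)
    split g = begin-equality
      ∏ (allFin k) c                   ≡⟨ product-↭ (↭-map⁺ c (proj₂ partition)) ⟩
      ∏ (map ι (allFin r) ++ js) c     ≡⟨ ∏-++ (map ι (allFin r)) js c ⟩
      ∏ (map ι (allFin r)) c * ∏ js c  ≡⟨ cong (_* ∏ js c) (trans (∏-map ι (allFin r) c)
                                            (trans (∏-cong (allFin r) (common-ι g)) (∏-allFin-const r _))) ⟩
      common a L g ^ r * ∏ js c        ∎
      where
      c : Fin k → ℕ
      c v = common a (S v) g
  eq : ∀ y z → y * (z * y) ≡ z * (y * y)
  eq = solve-∀

theorem1p3 : (r d : ℕ) → 1 ≤ r → 1 ≤ d →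
    (k : ℕ) (H : Graph k) (side : Fin k → Bool) →
    (∀ u v → adj H u v ≡ true → side v ≡ not (side u)) →
    (Σ (Fin r → Fin k) λ ι → Injective _≡_ _≡_ ι ×
    ((i : Fin r) → side (ι i) ≡ true ×
    ((w : Fin k) → side w ≡ false → adj H (ι i) w ≡ true))) →
    ((u : Fin k) → side u ≡ true → d ≤ degree H u) →
    (n : ℕ) (G : Graph (suc n)) →
    (homDensity (K r d) G ^ℚ edgeCount H) ≤ℚ (homDensity H G ^ℚ (r * d))
theorem1p3 r d r≥1 d≥1 k H side bipartite (ι , ι-injective , ι-complete) deg≥d n G =
  ^ℚ-mono-≤ (homCount (K r d) G) (suc n ^ (r + d)) {{m^n≢0 (suc n) (r + d)}} (edgeCount H)
            (homCount H G) (suc n ^ k) {{m^n≢0 (suc n) k}} (r * d)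
            (homCount-bound r≥1 d≥1 H side bipartite ι ι-injective ι-complete deg≥d (s≤s z≤n) G)
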